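{- Let $n \geq 2$. Then \[ \omega(\mathfrak{p}_n^+) = \#\Bigl\{ p \text{ prime} : p > \sqrt{n},\ \Bigl\lfloor \frac{n-1}{p-1} \Bigr\rfloor > \Bigl\lfloor \frac{n}{p} \Bigr\rfloor \Bigr\}. \] Moreover, \[ \omega(\mathfrak{p}_n^-) < \frac{5}{2}\frac{\sqrt{n}}{\log n} \quad\text{and}\quad \omega(\mathfrak{p}_n^+) < \sqrt{n}. \]
   Context: For a prime $p$ and an integer $n \geq 0$, $s_p(n)$ denotes the sum of the digits of $n$ in base $p$. For $n \geq 1$ define $\mathfrak{p}_n^- := \prod_{p < \sqrt{n},\ s_p(n) \geq p} p$ and $\mathfrak{p}_n^+ := \prod_{p > \sqrt{n},\ s_p(n) \geq p} p$, products over primes $p$ (empty product $=1$). $\omega(m)$ denotes the number of distinct prime divisors of $m$, and $\lfloor \cdot \rfloor$ the integer part. -}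

module Defs where

open import Data.Nat using (ℕ; zero; suc; _+_; _*_; _∸_; _^_; _≤_; _<_; _≤?_; _<?_)
open import Data.Nat.DivMod using (_/_; _%_)
open import Data.Nat.Divisibility using (_∣_; _∣?_)
open import Data.Nat.Primality using (Prime; prime?)
open import Data.List using (List; length; filter; upTo)
open import Data.Nat.ListAction using (product)
open import Data.Product using (_×_)
open import Data.Integer using (+_)
open import Data.Rational as ℚ using (ℚ; 0ℚ; 1ℚ)
open import Relation.Nullary.Decidable using (_×-dec_)

_div_ : ℕ → ℕ → ℕ
m div zero = 0
m div suc d = m / suc d

ds : ℕ → ℕ → ℕ → ℕ
ds zero _ _ = 0
ds (suc f) zero n = n
ds (suc f) (suc b) n = n % suc b + ds f (suc b) (n / suc b)

-- s_p(n): sum of the base-p digits of n (meaningful for p ≥ 2; fuel n+1 suffices)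
s : ℕ → ℕ → ℕ
s p n = ds (suc n) p n

-- 𝔭⁻_n = ∏_{p prime, p < √n, s_p(n) ≥ p} p   (p < √n ⇔ p*p < n).
-- Primes with s_p(n) ≥ p satisfy p ≤ n (for p > n, s_p(n) = n < p), so the range [0..n] is complete.
𝔭⁻ : ℕ → ℕ
𝔭⁻ n = product (filter (λ p → prime? p ×-dec (p * p <? n) ×-dec (p ≤? s p n)) (upTo (suc n)))

𝔭⁺ : ℕ → ℕ
𝔭⁺ n = product (filter (λ p → prime? p ×-dec (n <? p * p) ×-dec (p ≤? s p n)) (upTo (suc n)))

-- ω(m): number of distinct prime divisors of m (for m ≥ 1; every prime divisor is ≤ m)
ω : ℕ → ℕ
ω m = length (filter (λ p → prime? p ×-dec (p ∣? m)) (upTo (suc m)))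

ℕ→ℚ : ℕ → ℚ
ℕ→ℚ m = + m ℚ./ 1

expTerm : ℚ → ℕ → ℚ
expTerm q zero = 1ℚ
expTerm q (suc j) = expTerm q j ℚ.* q ℚ.* (+ 1 ℚ./ suc j)

expSum : ℚ → ℕ → ℚ
expSum q zero = 1ℚ
expSum q (suc K) = expSum q K ℚ.+ expTerm q (suc K)

-- LogBound w n  encodes the real inequality  w < (5/2) √n / log n  (for n ≥ 2, log n > 0),
-- i.e.  n^w < exp((5/2)√n), i.e. there is a rational 0 ≤ q < (5/2)√n  (q ≥ 0, 4q² < 25n)
-- and a partial sum of the exponential series at q exceeding n^w.
LogBound : ℕ → ℕ → Set
LogBound w n = Σ ℚ (λ q → (0ℚ ℚ.≤ q) × (ℕ→ℚ 4 ℚ.* q ℚ.* q ℚ.< ℕ→ℚ (25 * n))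
                         × Σ ℕ (λ K → ℕ→ℚ (n ^ w) ℚ.< expSum q K))
  where open import Data.Product using (Σ)

{-# OPTIONS --safe #-}

-- For p > √n, n = a p + b has the base-p digits a, b, and n - 1 = a (p - 1) + (a + b - 1), so that
-- s_p(n) ≥ p exactly when the quotient (n - 1)/(p - 1) exceeds a; on these primes p ↦ a is injective with a < √n.
--
-- For the small primes let y² < n ≤ (y + 1)² and Y = y + 1. Up to three exceptional y it suffices that
-- Y^π(y) ≤ exp (5y/4). This is checked by a sieve for y < 65536 and proved by induction beyond: Y^π(y) is the
-- product of the primes p ≤ y times the product of the Y/p. With m = ⌈y/42⌉, the primes in (m , 42m] all divide
-- the multinomial coefficient (42m)!/((21m)! (14m)! (6m)! m!) ≤ exp (1.08 · 42m), since 1/2 + 1/3 + 1/7 = 1 - 1/42,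
-- and those up to m are controlled by the induction hypothesis. The latter also gives π(t) ≤ t/8 + 59, so that
-- up to 60 factors the product of the Y/p is at most (Y/8)^J/J! ≤ exp (Y/8). Finally 1.08 + (5/4)/42 + 1/8 < 5/4.
-- For exceptional y some prime p < √n has s_p(n) < p, which lowers the exponent by one.
module Submission where

open import Defs
open import Data.List using (List; []; _∷_; length; filter; upTo; downFrom; applyDownFrom; _++_; [_])
open import Data.List.Membership.Propositional using (_∈_; find)
open import Data.List.Membership.Propositional.Properties using (∈-∃++; ∈-++⁺ˡ; ∈-++⁺ʳ; ∈-++⁻; ∈-filter⁺; ∈-filter⁻; ∈-upTo⁺; ∈-upTo⁻; ∈-applyDownFrom⁺; ∈-downFrom⁺)
open import Data.List.Relation.Unary.Unique.Propositional using (Unique)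
open import Data.Nat.Primality using (Prime; prime?; ¬prime[0]; ¬prime[1]; prime⇒nonZero; prime⇒nonTrivial; prime⇒irreducible; productOfPrimes≢0; euclidsLemma)
open import Data.Product using (_×_; _,_; proj₁; proj₂; ∃-syntax)
open import Function using (id; _∘_)
open import Function.Bundles using (_⇔_; mk⇔; Equivalence)
open import Relation.Binary.PropositionalEquality hiding ([_]; J)

-- The constant 5/2 leaves little room: at y = 19 already 8 log 20 > (5/4) 19. Central binomial
-- coefficients would only give log 4 = 1.386... per unit of y for the logarithm of the product of
-- the primes, which exceeds 5/4 before the factors Y/p are even counted. The numbers 2, 3, 7 open
-- Sylvester's sequence: no three unit fractions come closer to 1 from below. The multinomial
-- coefficient built on them costs (log 2)/2 + (log 3)/3 + (log 7)/7 + (log 42)/42 = 1.0797.... No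
-- real logarithm occurs. Every estimate has the form a ≤ g^N with g = 20201/20000, an inequality
-- between natural numbers, so that N bounds 100 log a from above. The base g is itself a partial
-- sum of the exponential series at 1/100, and a product of partial sums at nonnegative arguments is
-- dominated by a longer partial sum at the sum of the arguments. Hence an estimate of this form
-- turns directly into the witness that `LogBound` asks for.

module PrimeCounting where

  open import Data.Bool using (Bool; true; false; T; _∧_; _∨_; if_then_else_)
  open import Data.Bool.Properties using (T-∧; T-∨)
  open import Data.List.Properties using (length-++; length-applyDownFrom; filter-accept; filter-reject)
  open import Data.List.Relation.Unary.All as All using (All; []; _∷_; all?)
  open import Data.List.Relation.Unary.All.Properties using (¬Any⇒All¬)
  open import Data.List.Relation.Unary.AllPairs using ([]; _∷_)
  open import Data.List.Relation.Unary.Any using (Any; here; there; any?)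
  open import Data.List.Relation.Unary.Unique.Propositional.Properties using (filter⁺; upTo⁺; downFrom⁺)
  open import Data.Nat
  open import Data.Nat.Combinatorics using (k![n∸k]!∣n!)
  open import Data.Nat.Divisibility
  open import Data.Nat.DivMod hiding (_div_)
  open import Data.Nat.Induction using (<-rec)
  open import Data.Nat.ListAction using (product)
  open import Data.Nat.ListAction.Properties using (∈⇒∣product)
  open import Data.Nat.Primality.Factorisation using (factorisationHasAllPrimeFactors)
  open import Data.Nat.Properties
  open import Data.Nat.Tactic.RingSolver using (solve-∀)
  open import Data.Sum using (inj₁; inj₂; [_,_]′)
  open import Relation.Binary.Definitions using (tri<; tri≈; tri>)
  open import Relation.Nullary using (¬_; Dec; yes; no; contradiction)
  open import Relation.Nullary.Decidable using (_×-dec_; from-yes)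
  open import Relation.Unary using (Decidable)

  -- Prime divisors of a product of distinct primes

  length-injectiveOn : ∀ {A B : Set} (f : A → B) {xs : List A} {ys : List B} → Unique xs →
    (∀ {x x′} → x ∈ xs → x′ ∈ xs → f x ≡ f x′ → x ≡ x′) →
    (∀ {x} → x ∈ xs → f x ∈ ys) → length xs ≤ length ys
  length-injectiveOn f []       inj f∈ = z≤n
  length-injectiveOn f {x ∷ xs} {ys} (x∉xs ∷ xs!) inj f∈
    with as , bs , refl ← ∈-∃++ (f∈ (here refl)) = begin
      suc (length xs)               ≤⟨ s≤s (length-injectiveOn f xs! (λ p q → inj (there p) (there q)) f∈′) ⟩
      suc (length (as ++ bs))       ≡⟨ cong suc (length-++ as) ⟩
      suc (length as + length bs)   ≡⟨ +-suc (length as) (length bs) ⟨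
      length as + suc (length bs)   ≡⟨ length-++ as ⟨
      length (as ++ [ f x ] ++ bs)  ∎
    where
    open ≤-Reasoning
    f∈′ : ∀ {z} → z ∈ xs → f z ∈ as ++ bs
    f∈′ {z} z∈ with ∈-++⁻ as (f∈ (there z∈))
    ... | inj₁ z∈as            = ∈-++⁺ˡ z∈as
    ... | inj₂ (there z∈bs)    = ∈-++⁺ʳ as z∈bs
    ... | inj₂ (here fz≡fx)    = contradiction (sym (inj (there z∈) (here refl) fz≡fx)) (All.lookup x∉xs z∈)

  length-⊆ : ∀ {A : Set} {xs ys : List A} → Unique xs → (∀ {x} → x ∈ xs → x ∈ ys) → length xs ≤ length ys
  length-⊆ xs! = length-injectiveOn id xs! (λ _ _ eq → eq)

  -- By unique factorisation a prime divisor of a product of primes is one of the factors.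
  ω-product : ∀ {ps} → Unique ps → All Prime ps → ω (product ps) ≡ length ps
  ω-product {ps} ps! prs = ≤-antisym
    (length-⊆ (filter⁺ P? (upTo⁺ (suc (product ps)))) to) (length-⊆ ps! from)
    where
    P? = λ p → prime? p ×-dec (p ∣? product ps)
    to : ∀ {p} → p ∈ filter P? (upTo (suc (product ps))) → p ∈ ps
    to p∈ with _ , pr , p∣ ← ∈-filter⁻ P? {xs = upTo (suc (product ps))} p∈ = factorisationHasAllPrimeFactors pr p∣ prs
    from : ∀ {p} → p ∈ ps → p ∈ filter P? (upTo (suc (product ps)))
    from p∈ = ∈-filter⁺ P? (∈-upTo⁺ (s≤s (∣⇒≤ {{productOfPrimes≢0 prs}} (∈⇒∣product p∈))))
                           (All.lookup prs p∈ , ∈⇒∣product p∈)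

  ω-product-filter : ∀ {Q : ℕ → Set} (Q? : Decidable Q) m →
    ω (product (filter (λ p → prime? p ×-dec Q? p) (upTo m))) ≡ length (filter (λ p → prime? p ×-dec Q? p) (upTo m))
  ω-product-filter Q? m = ω-product (filter⁺ PQ? (upTo⁺ m))
    (All.tabulate (λ p∈ → proj₁ (proj₂ (∈-filter⁻ PQ? {xs = upTo m} p∈))))
    where PQ? = λ p → prime? p ×-dec Q? p

  -- Base-p digit sums for p > √n

  ds-zero : ∀ f p → ds f (suc p) 0 ≡ 0
  ds-zero zero    p = refl
  ds-zero (suc f) p = trans (cong (ds f (suc p)) (0/n≡0 (suc p))) (ds-zero f p)

  -- Below the square of the base the quotient is itself a digit, so the recursion of `ds` has
  -- nothing left after two steps and the remaining fuel only adds zeros.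
  s-twoDigits : ∀ p n → n < suc p * suc p → s (suc p) n ≡ n % suc p + n / suc p
  s-twoDigits p zero    _    = trans (ds-zero 1 p) (sym (cong (0 % suc p +_) (0/n≡0 (suc p))))
  s-twoDigits p (suc n) n<p² = cong (suc n % suc p +_) (begin
    a % suc p + ds n (suc p) (a / suc p)  ≡⟨ cong₂ (λ u v → u + ds n (suc p) v) (m<n⇒m%n≡m a<p) (m<n⇒m/n≡0 a<p) ⟩
    a + ds n (suc p) 0                    ≡⟨ cong (a +_) (ds-zero n p) ⟩
    a + 0                                 ≡⟨ +-identityʳ a ⟩
    a                                     ∎)
    where
    open ≡-Reasoning
    a = suc n / suc p
    a<p : a < suc p
    a<p = m<n*o⇒m/o<n n<p²

  m*n≤o⇒m≤o/n : ∀ m n o .{{_ : NonZero n}} → m * n ≤ o → m ≤ o / n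
  m*n≤o⇒m≤o/n m n o mn≤o = subst (_≤ o / n) (m*n/n≡m m n) (/-monoˡ-≤ n mn≤o)

  m≤o/n⇒m*n≤o : ∀ m n o .{{_ : NonZero n}} → m ≤ o / n → m * n ≤ o
  m≤o/n⇒m*n≤o m n o m≤ = ≤-trans (*-monoˡ-≤ n m≤) (m/n*n≤m o n)

  module _ (p n : ℕ) (n<p² : suc n < suc (suc p) * suc (suc p)) where

    private
      P = suc (suc p)
      a = suc n / P
      b = suc n % P

      n≡b+aP : suc n ≡ b + a * P
      n≡b+aP = m≡m%n+[m/n]*n (suc n) P

      expand : ∀ a b p → b + a * (2 + p) ≡ (b + a) + a * (1 + p)
      expand = solve-∀

      n≡s+a[P-1] : suc n ≡ s P (suc n) + a * suc p
      n≡s+a[P-1] = trans n≡b+aP (trans (expand a b p) (cong (_+ a * suc p) (sym (s-twoDigits (suc p) (suc n) n<p²))))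

    digitSum≥⇒quotient< : P ≤ s P (suc n) → suc n div P < n div suc p
    digitSum≥⇒quotient< P≤s = m*n≤o⇒m≤o/n (suc a) (suc p) n (≤-pred (begin
      suc (suc p + a * suc p)     ≤⟨ +-monoˡ-≤ (a * suc p) P≤s ⟩
      s P (suc n) + a * suc p     ≡⟨ n≡s+a[P-1] ⟨
      suc n                       ∎))
      where open ≤-Reasoning

    quotient<⇒digitSum≥ : suc n div P < n div suc p → P ≤ s P (suc n)
    quotient<⇒digitSum≥ q< = +-cancelʳ-≤ (a * suc p) P (s P (suc n)) (begin
      suc (suc p + a * suc p)     ≤⟨ s≤s (m≤o/n⇒m*n≤o (suc a) (suc p) n q<) ⟩
      suc n                       ≡⟨ n≡s+a[P-1] ⟩
      s P (suc n) + a * suc p     ∎)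
      where open ≤-Reasoning

    -- The set in the theorem has no upper limit, whereas `𝔭⁺` ranges over p ≤ n. Beyond n there is
    -- a single digit, and a digit is less than the base.
    digitSum≥⇒≤ : P ≤ s P (suc n) → P ≤ suc n
    digitSum≥⇒≤ P≤s with P ≤? suc n
    ... | yes P≤n = P≤n
    ... | no  P≰n = contradiction (begin
      P                ≤⟨ P≤s ⟩
      s P (suc n)      ≡⟨ s-twoDigits (suc p) (suc n) n<p² ⟩
      b + a            ≡⟨ cong (b +_) (m<n⇒m/n≡0 (≰⇒> P≰n)) ⟩
      b + 0            ≡⟨ +-identityʳ b ⟩
      b                ≤⟨ ≤-pred (m%n<n (suc n) P) ⟩
      suc p            ∎) 1+n≰n
      where open ≤-Reasoning

  -- The primes of 𝔭⁺ and their number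

  largePrimes : ℕ → List ℕ
  largePrimes n = filter (λ p → prime? p ×-dec (n <? p * p) ×-dec (p ≤? s p n)) (upTo (suc n))

  largePrimes-unique : ∀ n → Unique (largePrimes n)
  largePrimes-unique n = filter⁺ (λ p → prime? p ×-dec (n <? p * p) ×-dec (p ≤? s p n)) (upTo⁺ (suc n))

  ∈-largePrimes : ∀ n p → (p ∈ largePrimes (suc n)) ⇔ (Prime p × suc n < p * p × (suc n div p) < (n div (p ∸ 1)))
  ∈-largePrimes n p = mk⇔ to (from p)
    where
    P? = λ p → prime? p ×-dec (suc n <? p * p) ×-dec (p ≤? s p (suc n))
    to′ : ∀ p → Prime p → suc n < p * p → p ≤ s p (suc n) → (suc n div p) < (n div (p ∸ 1))
    to′ zero          pr = contradiction pr ¬prime[0]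
    to′ (suc zero)    pr = contradiction pr ¬prime[1]
    to′ (suc (suc q)) _  = digitSum≥⇒quotient< q n
    to : p ∈ largePrimes (suc n) → Prime p × suc n < p * p × (suc n div p) < (n div (p ∸ 1))
    to p∈ with _ , pr , n<p² , p≤s ← ∈-filter⁻ P? {xs = upTo (suc (suc n))} p∈ =
      pr , n<p² , to′ p pr n<p² p≤s
    from : ∀ p → Prime p × suc n < p * p × (suc n div p) < (n div (p ∸ 1)) → p ∈ largePrimes (suc n)
    from zero          (pr , _) = contradiction pr ¬prime[0]
    from (suc zero)    (pr , _) = contradiction pr ¬prime[1]
    from (suc (suc q)) (pr , n<p² , q<) =
      ∈-filter⁺ P? (∈-upTo⁺ (s≤s (digitSum≥⇒≤ q n n<p² p≤s))) (pr , n<p² , p≤s)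
      where p≤s = quotient<⇒digitSum≥ q n n<p² q<

  ω-𝔭⁺ : ∀ n → ω (𝔭⁺ n) ≡ length (largePrimes n)
  ω-𝔭⁺ n = ω-product-filter (λ p → (n <? p * p) ×-dec (p ≤? s p n)) (suc n)

  -- Here y is ⌈√n⌉ - 1 and not ⌊√n⌋: both bounds of the theorem are strict and are reached through
  -- y < √n.
  root : ∀ n → 1 < n → ∃[ y ] (0 < y × y * y < n × n ≤ suc y * suc y)
  root (suc (suc zero)) (s≤s 0<n) = 1 , s≤s z≤n , s≤s (s≤s z≤n) , s≤s (s≤s z≤n)
  root (suc (suc (suc n))) (s≤s 0<n) with root (suc (suc n)) (s≤s (s≤s z≤n))
  ... | y , 0<y , y²<n , n≤ with suc y * suc y <? suc (suc (suc n))
  ...   | yes <n = suc y , s≤s z≤n , <n , ≤-trans (s≤s n≤) (begin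
            suc (suc y * suc y)                          ≤⟨ m≤m+n _ _ ⟩
            suc (suc y * suc y) + (2 + 2 * y)            ≡⟨ eq y ⟩
            suc (suc y) * suc (suc y)                    ∎)
    where
    open ≤-Reasoning
    eq : ∀ y → suc (suc y * suc y) + (2 + 2 * y) ≡ suc (suc y) * suc (suc y)
    eq = solve-∀
  ...   | no  ≮n = y , 0<y , m<n⇒m<1+n y²<n , ≮⇒≥ ≮n

  -- p ↦ ⌊n/p⌋ is injective on these primes: if p < p′ have the common quotient a, then
  -- n < (a + 1) p ≤ (a + 1)(p′ - 1) ≤ n - 1.
  ω-𝔭⁺-<√ : ∀ n → 1 < n → ω (𝔭⁺ n) * ω (𝔭⁺ n) < n
  ω-𝔭⁺-<√ n@(suc k) 1<n with root n 1<n
  ... | y , _ , y²<n , n≤ = ≤-<-trans (*-mono-≤ ω≤y ω≤y) y²<n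
    where
    open ≤-Reasoning
    q-inj : ∀ p p′ → Prime p → Prime p′ → n div p ≡ n div p′ → (n div p′) < (k div (p′ ∸ 1)) → ¬ (p < p′)
    q-inj (suc p) (suc (suc p′)) _ _ eq q< (s≤s p<p′) = 1+n≰n {n} (begin
      suc n                              ≤⟨ s≤s (≤-reflexive (m≡m%n+[m/n]*n n (suc p))) ⟩
      suc (n % suc p + n / suc p * suc p) ≤⟨ +-monoˡ-≤ (n / suc p * suc p) (m%n<n n (suc p)) ⟩
      suc (n / suc p) * suc p            ≡⟨ cong (λ a → suc a * suc p) eq ⟩
      suc (n / suc (suc p′)) * suc p     ≤⟨ *-monoʳ-≤ (suc (n / suc (suc p′))) p<p′ ⟩
      suc (n / suc (suc p′)) * suc p′    ≤⟨ m≤o/n⇒m*n≤o _ (suc p′) k q< ⟩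
      k                                  ≤⟨ n≤1+n k ⟩
      n                                  ∎)
    q-inj (suc p) (suc zero) _ _ eq q< (s≤s ())
    q-inj zero p′ pr with () ← prime⇒nonZero pr
    ∈⇒ : ∀ {p} → p ∈ largePrimes n → Prime p × n < p * p × (n div p) < (k div (p ∸ 1))
    ∈⇒ {p} = Equivalence.to (∈-largePrimes k p)
    inj : ∀ {p p′} → p ∈ largePrimes n → p′ ∈ largePrimes n → n div p ≡ n div p′ → p ≡ p′
    inj {p} {p′} p∈ p′∈ eq with ∈⇒ p∈ | ∈⇒ p′∈ | <-cmp p p′
    ... | pr , _ , _ | pr′ , _ , q′ | tri< p<p′ _ _ = contradiction p<p′ (q-inj p p′ pr pr′ eq q′)
    ... | _          | _            | tri≈ _ p≡p′ _ = p≡p′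
    ... | pr , _ , q | pr′ , _ , _  | tri> _ _ p′<p = contradiction p′<p (q-inj p′ p pr′ pr (sym eq) q)
    -- The quotient a = ⌊n/p⌋ is positive because p ≤ n, and a < p because n < p². Hence a > y would
    -- give n ≤ (y + 1)² ≤ a² < a p ≤ n.
    quotient∈ : ∀ {p} → p ∈ largePrimes n → n div p ∈ applyDownFrom suc y
    quotient∈ {zero} p∈ with () ← prime⇒nonZero (proj₁ (∈⇒ p∈))
    quotient∈ p@{suc p-1} p∈ with n / suc p-1 in eq | ∈-upTo⁻ (proj₁ (∈-filter⁻ (λ p → prime? p ×-dec (n <? p * p) ×-dec (p ≤? s p n)) {xs = upTo (suc n)} p∈))
    ... | zero  | s≤s p≤n = contradiction (subst (0 <_) eq (m≥n⇒m/n>0 p≤n)) 1+n≰n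
    ... | suc a | _       = ∈-applyDownFrom⁺ suc (≤-pred (≰⇒> λ y<a → <-irrefl refl (begin-strict
      n                  ≤⟨ n≤ ⟩
      suc y * suc y      ≤⟨ *-mono-≤ y<a y<a ⟩
      suc a * suc a      <⟨ *-monoʳ-< (suc a) (m<n*o⇒m/o<n′ eq) ⟩
      suc a * suc p-1    ≤⟨ m≤o/n⇒m*n≤o (suc a) (suc p-1) n (≤-reflexive (sym eq)) ⟩
      n                  ∎)))
      where
      m<n*o⇒m/o<n′ : n / suc p-1 ≡ suc a → suc a < suc p-1
      m<n*o⇒m/o<n′ eq = subst (_< suc p-1) eq (m<n*o⇒m/o<n (proj₁ (proj₂ (∈⇒ p∈))))
    ω≤y : ω (𝔭⁺ n) ≤ y
    ω≤y = begin
      ω (𝔭⁺ n)                         ≡⟨ ω-𝔭⁺ n ⟩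
      length (largePrimes n)           ≤⟨ length-injectiveOn (n div_) (largePrimes-unique n) inj quotient∈ ⟩
      length (applyDownFrom suc y)     ≡⟨ length-applyDownFrom suc y ⟩
      y                                ∎

  -- Primorials and the multinomial coefficient of 42m

  opaque
    primesTo : ℕ → List ℕ
    primesTo t = filter prime? (downFrom (suc t))

    primesTo-0 : primesTo 0 ≡ []
    primesTo-0 = refl

    primesTo-prime : ∀ {t} → Prime (suc t) → primesTo (suc t) ≡ suc t ∷ primesTo t
    primesTo-prime pr = filter-accept prime? pr

    primesTo-¬prime : ∀ {t} → ¬ Prime (suc t) → primesTo (suc t) ≡ primesTo t
    primesTo-¬prime ¬pr = filter-reject prime? ¬pr

    primesTo-unique : ∀ t → Unique (primesTo t)
    primesTo-unique t = filter⁺ prime? (downFrom⁺ (suc t))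

    ∈-primesTo : ∀ {p t} → Prime p → p ≤ t → p ∈ primesTo t
    ∈-primesTo pr p≤t = ∈-filter⁺ prime? (∈-downFrom⁺ (s≤s p≤t)) pr

  π : ℕ → ℕ
  π t = length (primesTo t)

  primorial : ℕ → ℕ
  primorial t = product (primesTo t)

  -- The multiples of the prime contribute its q-th power times q!, and the other factors are prime
  -- to it. This is a single step of Legendre's formula; the higher powers of the prime stay inside
  -- q!.
  factorial-split : ∀ {p} → Prime (suc p) → ∀ q r → r ≤ p →
    ∃[ u ] (¬ (suc p ∣ u) × (r + q * suc p) ! ≡ suc p ^ q * q ! * u)
  factorial-split {p} pr zero    zero    _   = 1 , >⇒∤ (nonTrivial⇒n>1 (suc p) {{prime⇒nonTrivial pr}}) , refl
  factorial-split {p} pr (suc q) zero    _   with u , p∤u , eq ← factorial-split pr q p ≤-refl =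
    u , p∤u , trans (cong (suc q * suc p *_) eq) (shuffle (suc q) (suc p) (suc p ^ q) (q !) u)
    where
    shuffle : ∀ q p pᵠ q! u → q * p * (pᵠ * q! * u) ≡ p * pᵠ * (q * q!) * u
    shuffle = solve-∀
  factorial-split {p} pr q       (suc r) r<p with u , p∤u , eq ← factorial-split pr q r (<⇒≤ r<p) =
    n * u , p∤n*u , trans (cong (n *_) eq) (shuffle n (suc p ^ q * q !) u)
    where
    n = suc r + q * suc p
    p∤n*u : ¬ (suc p ∣ n * u)
    p∤n*u p∣ with euclidsLemma n u pr p∣
    ... | inj₁ p∣n = >⇒∤ (s≤s r<p) (∣m+n∣m⇒∣n (subst (suc p ∣_) (+-comm (suc r) (q * suc p)) p∣n) (n∣m*n q))
    ... | inj₂ p∣u = p∤u p∣u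
    shuffle : ∀ n a u → n * (a * u) ≡ a * (n * u)
    shuffle = solve-∀

  factorial-split′ : ∀ {p} → Prime (suc p) → ∀ n →
    ∃[ u ] (¬ (suc p ∣ u) × n ! ≡ suc p ^ (n / suc p) * (n / suc p) ! * u)
  factorial-split′ {p} pr n with u , p∤u , eq ← factorial-split pr (n / suc p) (n % suc p) (≤-pred (m%n<n n (suc p))) =
    u , p∤u , trans (cong _! (m≡m%n+[m/n]*n n (suc p))) eq

  prime∤factorial : ∀ {p m} → Prime p → m < p → ¬ (p ∣ m !)
  prime∤factorial {zero}  pr = contradiction pr ¬prime[0]
  prime∤factorial {suc p} {m} pr m<p p∣m! with factorial-split′ pr m
  ... | u , p∤u , eq rewrite m<n⇒m/n≡0 m<p = p∤u (subst (suc p ∣_) (trans eq (+-identityʳ u)) p∣m!)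

  m!n!∣[m+n]! : ∀ m n → m ! * n ! ∣ (m + n) !
  m!n!∣[m+n]! m n = subst (λ k → m ! * k ! ∣ (m + n) !) (m+n∸m≡n m n) (k![n∸k]!∣n! (m≤m+n m n))

  multinomial∣ : ∀ {b c d a} → b + c + d ≤ a → b ! * c ! * d ! ∣ a !
  multinomial∣ {b} {c} {d} {a} b+c+d≤a =
    ∣-trans (*-monoˡ-∣ (d !) (m!n!∣[m+n]! b c))
    (∣-trans (m!n!∣[m+n]! (b + c) d) (m≤n⇒m!∣n! b+c+d≤a))

  -- Weighted by 21, 14 and 6 the three bounds add up to 42 (b + c + d) ≤ 41 a, which is less than
  -- 42 a.
  2b,3c,7d≤a⇒b+c+d<a : ∀ {a b c d} → 0 < a → b * 2 ≤ a → c * 3 ≤ a → d * 7 ≤ a → b + c + d < a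
  2b,3c,7d≤a⇒b+c+d<a {a} {b} {c} {d} 0<a 2b≤a 3c≤a 7d≤a = *-cancelʳ-< 42 (b + c + d) a (begin-strict
    (b + c + d) * 42                              ≡⟨ lhs b c d ⟩
    b * 2 * 21 + c * 3 * 14 + d * 7 * 6           ≤⟨ +-mono-≤ (+-mono-≤ (*-monoˡ-≤ 21 2b≤a) (*-monoˡ-≤ 14 3c≤a)) (*-monoˡ-≤ 6 7d≤a) ⟩
    a * 21 + a * 14 + a * 6                       <⟨ m<m+n _ 0<a ⟩
    a * 21 + a * 14 + a * 6 + a                   ≡⟨ rhs a ⟩
    a * 42                                        ∎)
    where
    open ≤-Reasoning
    lhs : ∀ b c d → (b + c + d) * 42 ≡ b * 2 * 21 + c * 3 * 14 + d * 7 * 6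
    lhs = solve-∀
    rhs : ∀ a → a * 21 + a * 14 + a * 6 + a ≡ a * 42
    rhs = solve-∀

  -- Let a, b, c, d be the quotients of 42m, 21m, 14m, 6m by p. One step of Legendre's formula
  -- exhibits p^a a! on the left of the equation and p^(b+c+d) b! c! d! on the right, next to M and
  -- factors prime to p. Since b! c! d! divides a!, the higher powers of p never have to be counted,
  -- and b + c + d < a leaves a factor p for M.
  prime∣multinomial : ∀ {m p M} → Prime p → m < p → p ≤ m * 42 →
    (m * 42) ! ≡ M * ((m * 21) ! * (m * 14) ! * (m * 6) ! * m !) → p ∣ M
  prime∣multinomial {p = zero} pr = contradiction pr ¬prime[0]
  prime∣multinomial {m} {p@(suc p-1)} {M} pr m<p p≤42m eq
    with factorial-split′ pr (m * 42) | factorial-split′ pr (m * 21) | factorial-split′ pr (m * 14) | factorial-split′ pr (m * 6)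
  ... | u₀ , _ , eq₀ | u₁ , p∤u₁ , eq₁ | u₂ , p∤u₂ , eq₂ | u₃ , p∤u₃ , eq₃ =
    drop p∤u₁ (drop p∤u₂ (drop p∤u₃ (drop (prime∤factorial pr m<p) p∣Mu)))
    where
    a = m * 42 / p
    b = m * 21 / p
    c = m * 14 / p
    d = m * 6 / p
    drop : ∀ {x y} → ¬ (p ∣ y) → p ∣ x * y → p ∣ x
    drop {x} {y} p∤y p∣xy = [ (λ p∣x → p∣x) , (λ p∣y → contradiction p∣y p∤y) ]′ (euclidsLemma x y pr p∣xy)
    quotient-scale : ∀ j k → j * k ≡ 42 → m * j / p * k ≤ a
    quotient-scale j k jk≡42 = m*n≤o⇒m≤o/n (m * j / p * k) p (m * 42) (begin
      m * j / p * k * p     ≡⟨ comm (m * j / p) k p ⟩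
      m * j / p * p * k     ≤⟨ *-monoˡ-≤ k (m/n*n≤m (m * j) p) ⟩
      m * j * k             ≡⟨ *-assoc m j k ⟩
      m * (j * k)           ≡⟨ cong (m *_) jk≡42 ⟩
      m * 42                ∎)
      where
      open ≤-Reasoning
      comm : ∀ x k p → x * k * p ≡ x * p * k
      comm = solve-∀
    b+c+d<a : b + c + d < a
    b+c+d<a = 2b,3c,7d≤a⇒b+c+d<a {a} {b} {c} {d} (m≥n⇒m/n>0 p≤42m) (quotient-scale 21 2 refl) (quotient-scale 14 3 refl) (quotient-scale 6 7 refl)
    D = p ^ (b + c + d) * (b ! * c ! * d !)
    X = quotient (multinomial∣ {b} {c} {d} (<⇒≤ b+c+d<a))
    e = a ∸ suc (b + c + d)
    p^a : p ^ a ≡ p * p ^ e * p ^ (b + c + d)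
    p^a = trans (cong (p ^_) (sym (m∸n+n≡m b+c+d<a))) (trans (cong (p ^_) (+-suc e (b + c + d))) (^-distribˡ-+-* p (suc e) (b + c + d)))
    p^bcd : p ^ (b + c + d) ≡ p ^ b * p ^ c * p ^ d
    p^bcd = trans (^-distribˡ-+-* p (b + c) d) (cong (_* p ^ d) (^-distribˡ-+-* p b c))
    shuffleˡ : ∀ p pᵉ P X D u → p * (pᵉ * X * u) * (P * D) ≡ (p * pᵉ * P) * (X * D) * u
    shuffleˡ = solve-∀
    shuffleʳ : ∀ M pb pc pd b! c! d! u₁ u₂ u₃ m! →
      M * (pb * b! * u₁ * (pc * c! * u₂) * (pd * d! * u₃) * m!) ≡ M * u₁ * u₂ * u₃ * m! * (pb * pc * pd * (b! * c! * d!))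
    shuffleʳ = solve-∀
    D≢0 : NonZero D
    D≢0 = m*n≢0 (p ^ (b + c + d)) (b ! * c ! * d !) {{m^n≢0 p (b + c + d)}}
            {{m*n≢0 (b ! * c !) (d !) {{m*n≢0 (b !) (c !) {{b !≢0}} {{c !≢0}}}} {{d !≢0}}}}
    cancelled : p * (p ^ e * X * u₀) ≡ M * u₁ * u₂ * u₃ * m !
    cancelled = *-cancelʳ-≡ _ _ D {{D≢0}} (begin
      p * (p ^ e * X * u₀) * D                           ≡⟨ shuffleˡ p (p ^ e) (p ^ (b + c + d)) X (b ! * c ! * d !) u₀ ⟩
      p * p ^ e * p ^ (b + c + d) * (X * (b ! * c ! * d !)) * u₀
        ≡⟨ cong₂ (λ s t → s * t * u₀) (sym p^a) (sym (_∣_.equality (multinomial∣ {b} {c} {d} (<⇒≤ b+c+d<a)))) ⟩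
      p ^ a * a ! * u₀                                   ≡⟨ eq₀ ⟨
      (m * 42) !                                         ≡⟨ eq ⟩
      M * ((m * 21) ! * (m * 14) ! * (m * 6) ! * m !)
        ≡⟨ cong (λ t → M * (t * m !)) (cong₂ _*_ (cong₂ _*_ eq₁ eq₂) eq₃) ⟩
      M * (p ^ b * b ! * u₁ * (p ^ c * c ! * u₂) * (p ^ d * d ! * u₃) * m !)
        ≡⟨ shuffleʳ M (p ^ b) (p ^ c) (p ^ d) (b !) (c !) (d !) u₁ u₂ u₃ (m !) ⟩
      M * u₁ * u₂ * u₃ * m ! * (p ^ b * p ^ c * p ^ d * (b ! * c ! * d !))
        ≡⟨ cong (λ t → M * u₁ * u₂ * u₃ * m ! * (t * (b ! * c ! * d !))) (sym p^bcd) ⟩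
      M * u₁ * u₂ * u₃ * m ! * D  ∎)
      where open ≡-Reasoning
    p∣Mu : p ∣ M * u₁ * u₂ * u₃ * m !
    p∣Mu = subst (p ∣_) cancelled (m∣m*n (p ^ e * X * u₀))

  -- Q is the product of the primes in the interval from m + 1 to j + m. The bound on its prime
  -- divisors is carried along because it keeps the next prime p from dividing Q: with M = r Q, the
  -- prime p must then divide r.
  primorial-split : ∀ {m M} j → (∀ {p} → Prime p → m < p → p ≤ j + m → p ∣ M) →
    ∃[ Q ] (primorial (j + m) ≡ Q * primorial m × Q ∣ M × (∀ {p} → Prime p → p ∣ Q → p ≤ j + m))
  primorial-split {m} zero _ = 1 , sym (+-identityʳ (primorial m)) , 1∣ _ ,
    λ pr p∣1 → contradiction p∣1 (>⇒∤ (nonTrivial⇒n>1 _ {{prime⇒nonTrivial pr}}))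
  primorial-split {m} {M} (suc j) p∣M
    with primorial-split j (λ pr m<p p≤ → p∣M pr m<p (m≤n⇒m≤1+n p≤)) | prime? (suc (j + m))
  ... | Q , eq , Q∣M , Q-primes | no ¬pr =
    Q , trans (cong product (primesTo-¬prime ¬pr)) eq , Q∣M , λ pr p∣Q → m≤n⇒m≤1+n (Q-primes pr p∣Q)
  ... | Q , eq , divides r refl , Q-primes | yes pr =
    p * Q , trans (cong product (primesTo-prime pr)) (trans (cong (p *_) eq) (sym (*-assoc p Q (primorial m)))) ,
    *-monoˡ-∣ Q p∣r , bound
    where
    p = suc (j + m)
    p∣r : p ∣ r
    p∣r with euclidsLemma r Q pr (p∣M pr (s≤s (m≤n+m m j)) ≤-refl)
    ... | inj₁ p∣r = p∣r
    ... | inj₂ p∣Q = contradiction (Q-primes pr p∣Q) 1+n≰n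
    bound : ∀ {p′} → Prime p′ → p′ ∣ p * Q → p′ ≤ p
    bound pr′ p′∣ with euclidsLemma p Q pr′ p′∣
    ... | inj₁ p′∣p = ∣⇒≤ p′∣p
    ... | inj₂ p′∣Q = m≤n⇒m≤1+n (Q-primes pr′ p′∣Q)

  -- The term of index (i , j) of the binomial expansion of (a + b)^(i+j), times i! j!.
  binomial-term≤ : ∀ a b i j → (i + j) ! * (a ^ i * b ^ j) ≤ i ! * j ! * (a + b) ^ (i + j)
  binomial-term≤ a b zero j = begin
    j ! * (1 * b ^ j)          ≡⟨ cong (j ! *_) (*-identityˡ (b ^ j)) ⟩
    j ! * b ^ j                ≤⟨ *-monoʳ-≤ (j !) (^-monoˡ-≤ j (m≤n+m b a)) ⟩
    j ! * (a + b) ^ j          ≡⟨ cong (_* (a + b) ^ j) (sym (*-identityˡ (j !))) ⟩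
    1 * j ! * (a + b) ^ j      ∎
    where open ≤-Reasoning
  binomial-term≤ a b (suc i) zero rewrite +-identityʳ i = begin
    suc i ! * (a ^ suc i * 1)        ≡⟨ cong (suc i ! *_) (*-identityʳ (a ^ suc i)) ⟩
    suc i ! * a ^ suc i              ≤⟨ *-monoʳ-≤ (suc i !) (^-monoˡ-≤ (suc i) (m≤m+n a b)) ⟩
    suc i ! * (a + b) ^ suc i        ≡⟨ cong (_* (a + b) ^ suc i) (sym (*-identityʳ (suc i !))) ⟩
    suc i ! * 1 * (a + b) ^ suc i    ∎
    where open ≤-Reasoning
  binomial-term≤ a b (suc i) (suc j) = begin
    suc (i + suc j) * (i + suc j) ! * (a * a ^ i * (b * b ^ j))
      -- Pascal's rule, cross-multiplied: the factor i + j + 2 is split into (i + 1) + (j + 1).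
      ≡⟨ split i j a b ((i + suc j) !) (a ^ i) (b ^ j) ⟩
    suc i * a * ((i + suc j) ! * (a ^ i * (b * b ^ j))) + suc j * b * ((i + suc j) ! * (a * a ^ i * b ^ j))
      ≤⟨ +-mono-≤ (*-monoʳ-≤ (suc i * a) (binomial-term≤ a b i (suc j))) (*-monoʳ-≤ (suc j * b) second) ⟩
    suc i * a * (i ! * (suc j * j !) * (a + b) ^ (i + suc j)) + suc j * b * (suc i * i ! * j ! * (a + b) ^ (i + suc j))
      ≡⟨ join i j a b (i !) (j !) ((a + b) ^ (i + suc j)) ⟩
    suc i * i ! * (suc j * j !) * ((a + b) * (a + b) ^ (i + suc j))  ∎
    where
    open ≤-Reasoning
    second : (i + suc j) ! * (a * a ^ i * b ^ j) ≤ suc i * i ! * j ! * (a + b) ^ (i + suc j)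
    second rewrite +-suc i j = binomial-term≤ a b (suc i) j
    split : ∀ i j a b f x y → suc (i + suc j) * f * (a * x * (b * y)) ≡
            suc i * a * (f * (x * (b * y))) + suc j * b * (f * (a * x * y))
    split = solve-∀
    join : ∀ i j a b i! j! s → suc i * a * (i! * (suc j * j!) * s) + suc j * b * (suc i * i! * j! * s) ≡
           suc i * i! * (suc j * j!) * ((a + b) * s)
    join = solve-∀

  -- One term of the expansion of (21 + 14 + 6 + 1)^(42m) is at most the whole. Binomial terms
  -- suffice, through 42 = 21 + 21, 21 = 14 + 7 and 7 = 6 + 1; what the three steps have in common
  -- on both sides makes up `K` and cancels.
  multinomial≤ : ∀ m M → (m * 42) ! ≡ M * ((m * 21) ! * (m * 14) ! * (m * 6) ! * m !) →
    M * (21 ^ (m * 21) * 14 ^ (m * 14) * 6 ^ (m * 6)) ≤ 42 ^ (m * 42)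
  multinomial≤ m M eq = *-cancelʳ-≤ _ _ K {{K≢0}} (begin
    M * (A₂₁ * A₁₄ * A₆) * K                                                ≡⟨ s₁ M A₂₁ A₁₄ A₆ A₇ f₂₁ f₁₄ f₇ f₆ f₁ ⟩
    (M * (f₂₁ * f₁₄ * f₆ * f₁)) * (A₂₁ * A₂₁) * (f₂₁ * (A₁₄ * A₇)) * (f₇ * (A₆ * 1))
       ≡⟨ cong (λ t → t * (A₂₁ * A₂₁) * (f₂₁ * (A₁₄ * A₇)) * (f₇ * (A₆ * 1))) (sym eq) ⟩
    (m * 42) ! * (A₂₁ * A₂₁) * (f₂₁ * (A₁₄ * A₇)) * (f₇ * (A₆ * 1))
       ≤⟨ *-mono-≤ (*-mono-≤ t₁ t₂) t₃ ⟩
    (f₂₁ * f₂₁ * 42 ^ (m * 42)) * (f₁₄ * f₇ * A₂₁) * (f₆ * f₁ * A₇)         ≡⟨ s₂ (42 ^ (m * 42)) A₂₁ A₇ f₂₁ f₁₄ f₇ f₆ f₁ ⟩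
    42 ^ (m * 42) * K                                                       ∎)
    where
    open ≤-Reasoning
    A₂₁ = 21 ^ (m * 21)
    A₁₄ = 14 ^ (m * 14)
    A₇  = 7 ^ (m * 7)
    A₆  = 6 ^ (m * 6)
    f₂₁ = (m * 21) !
    f₁₄ = (m * 14) !
    f₇  = (m * 7) !
    f₆  = (m * 6) !
    f₁  = m !
    K = A₂₁ * A₇ * (f₂₁ * f₂₁ * f₁₄ * f₇ * f₆ * f₁)
    K≢0 : NonZero K
    K≢0 = m*n≢0 _ _ {{m*n≢0 _ _ {{m^n≢0 21 (m * 21)}} {{m^n≢0 7 (m * 7)}}}}
      {{m*n≢0 _ _ {{m*n≢0 _ _ {{m*n≢0 _ _ {{m*n≢0 _ _ {{m*n≢0 _ _ {{(m * 21) !≢0}} {{(m * 21) !≢0}}}} {{(m * 14) !≢0}}}} {{(m * 7) !≢0}}}} {{(m * 6) !≢0}}}} {{m !≢0}}}}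
    s₁ : ∀ M A₂₁ A₁₄ A₆ A₇ f₂₁ f₁₄ f₇ f₆ f₁ → M * (A₂₁ * A₁₄ * A₆) * (A₂₁ * A₇ * (f₂₁ * f₂₁ * f₁₄ * f₇ * f₆ * f₁)) ≡
      (M * (f₂₁ * f₁₄ * f₆ * f₁)) * (A₂₁ * A₂₁) * (f₂₁ * (A₁₄ * A₇)) * (f₇ * (A₆ * 1))
    s₁ = solve-∀
    s₂ : ∀ A₄₂ A₂₁ A₇ f₂₁ f₁₄ f₇ f₆ f₁ → (f₂₁ * f₂₁ * A₄₂) * (f₁₄ * f₇ * A₂₁) * (f₆ * f₁ * A₇) ≡
      A₄₂ * (A₂₁ * A₇ * (f₂₁ * f₂₁ * f₁₄ * f₇ * f₆ * f₁))
    s₂ = solve-∀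
    t₁ : (m * 42) ! * (A₂₁ * A₂₁) ≤ f₂₁ * f₂₁ * 42 ^ (m * 42)
    t₁ = subst (λ k → k ! * (A₂₁ * A₂₁) ≤ f₂₁ * f₂₁ * 42 ^ k) (sym (*-distribˡ-+ m 21 21)) (binomial-term≤ 21 21 (m * 21) (m * 21))
    t₂ : f₂₁ * (A₁₄ * A₇) ≤ f₁₄ * f₇ * A₂₁
    t₂ = subst (λ k → k ! * (A₁₄ * A₇) ≤ f₁₄ * f₇ * 21 ^ k) (sym (*-distribˡ-+ m 14 7)) (binomial-term≤ 14 7 (m * 14) (m * 7))
    t₃ : f₇ * (A₆ * 1) ≤ f₆ * f₁ * A₇
    t₃ = subst (λ k → f₇ * (A₆ * k) ≤ f₆ * f₁ * A₇) (^-zeroˡ m)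
      (subst (λ k → k ! * (A₆ * 1 ^ m) ≤ f₆ * f₁ * 7 ^ k) (trans (cong (m * 6 +_) (sym (*-identityʳ m))) (sym (*-distribˡ-+ m 6 1))) (binomial-term≤ 6 1 (m * 6) m))

  primorial-42≤ : ∀ m M → (m * 42) ! ≡ M * ((m * 21) ! * (m * 14) ! * (m * 6) ! * m !) →
    primorial (m * 42) ≤ M * primorial m
  primorial-42≤ m M eq = bound (primorial-split {m} {M} (m * 41) λ {p} pr m<p p≤ →
      prime∣multinomial pr m<p (subst (p ≤_) 41m+m p≤) eq)
    where
    open ≤-Reasoning
    41m+m : m * 41 + m ≡ m * 42
    41m+m = trans (cong (m * 41 +_) (sym (*-identityʳ m))) (sym (*-distribˡ-+ m 41 1))
    M≢0 : NonZero M
    M≢0 = m*n≢0⇒m≢0 M {{subst NonZero eq ((m * 42) !≢0)}}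
    bound : ∃[ Q ] (primorial (m * 41 + m) ≡ Q * primorial m × Q ∣ M × (∀ {p} → Prime p → p ∣ Q → p ≤ m * 41 + m)) →
      primorial (m * 42) ≤ M * primorial m
    bound (Q , P≡ , Q∣M , _) = begin
      primorial (m * 42)        ≡⟨ cong primorial 41m+m ⟨
      primorial (m * 41 + m)    ≡⟨ P≡ ⟩
      Q * primorial m           ≤⟨ *-monoˡ-≤ (primorial m) (∣⇒≤ {{M≢0}} Q∣M) ⟩
      M * primorial m           ∎

  multinomial-exists : ∀ m → ∃[ M ] ((m * 42) ! ≡ M * ((m * 21) ! * (m * 14) ! * (m * 6) ! * m !))
  multinomial-exists m = quotient F∣ , _∣_.equality F∣
    where
    sum : ∀ m → m * 21 + m * 14 + m * 6 + m ≡ m * 42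
    sum = solve-∀
    F∣ : (m * 21) ! * (m * 14) ! * (m * 6) ! * m ! ∣ (m * 42) !
    F∣ = ∣-trans (*-monoˡ-∣ (m !) (multinomial∣ {m * 21} {m * 14} {m * 6} ≤-refl))
          (∣-trans (m!n!∣[m+n]! (m * 21 + m * 14 + m * 6) m) (m≤n⇒m!∣n! (≤-reflexive (sum m))))

  -- Exponential estimates by powers of 20201/20000

  ^-distribʳ-* : ∀ m n k → (m * n) ^ k ≡ m ^ k * n ^ k
  ^-distribʳ-* m n zero    = refl
  ^-distribʳ-* m n (suc k) = trans (cong (m * n *_) (^-distribʳ-* m n k)) (interchange m n (m ^ k) (n ^ k))
    where
    interchange : ∀ a b c d → a * b * (c * d) ≡ a * c * (b * d)
    interchange = solve-∀

  -- a ≼ N means a ≤ g^N for g = 20201/20000 = 1 + 1/100 + (1/100)²/2, a little less than exp (1/100).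
  record _≼_ (a N : ℕ) : Set where
    constructor mk≼
    field bound : a * 20000 ^ N ≤ 20201 ^ N

  infix 4 _≼_

  ≼-compute : ∀ a N → T (a * 20000 ^ N ≤ᵇ 20201 ^ N) → a ≼ N
  ≼-compute a N t = mk≼ (≤ᵇ⇒≤ (a * 20000 ^ N) (20201 ^ N) t)

  ≼-* : ∀ {a b M N} → a ≼ M → b ≼ N → a * b ≼ M + N
  ≼-* {a} {b} {M} {N} (mk≼ p) (mk≼ q) = mk≼ (begin
    a * b * 20000 ^ (M + N)               ≡⟨ cong (a * b *_) (^-distribˡ-+-* 20000 M N) ⟩
    a * b * (20000 ^ M * 20000 ^ N)       ≡⟨ interchange a b (20000 ^ M) (20000 ^ N) ⟩
    a * 20000 ^ M * (b * 20000 ^ N)       ≤⟨ *-mono-≤ p q ⟩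
    20201 ^ M * 20201 ^ N                 ≡⟨ ^-distribˡ-+-* 20201 M N ⟨
    20201 ^ (M + N)                       ∎)
    where
    open ≤-Reasoning
    interchange : ∀ a b c d → a * b * (c * d) ≡ a * c * (b * d)
    interchange = solve-∀

  ≼-1 : 1 ≼ 0
  ≼-1 = mk≼ ≤-refl

  ≼-^ : ∀ {a M} k → a ≼ M → a ^ k ≼ k * M
  ≼-^ zero    _ = ≼-1
  ≼-^ (suc k) p = ≼-* p (≼-^ k p)

  ≼-mono : ∀ {a b M N} → a ≤ b → M ≤ N → b ≼ M → a ≼ N
  ≼-mono {a} {b} {M} {N} a≤b M≤N (mk≼ p) = mk≼ (begin
    a * 20000 ^ N                          ≡⟨ cong (λ k → a * 20000 ^ k) (m+[n∸m]≡n M≤N) ⟨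
    a * 20000 ^ (M + (N ∸ M))              ≡⟨ cong (a *_) (^-distribˡ-+-* 20000 M (N ∸ M)) ⟩
    a * (20000 ^ M * 20000 ^ (N ∸ M))      ≡⟨ *-assoc a (20000 ^ M) _ ⟨
    a * 20000 ^ M * 20000 ^ (N ∸ M)        ≤⟨ *-mono-≤ (≤-trans (*-monoˡ-≤ (20000 ^ M) a≤b) p) (^-monoˡ-≤ (N ∸ M) 20000≤20201) ⟩
    20201 ^ M * 20201 ^ (N ∸ M)            ≡⟨ ^-distribˡ-+-* 20201 M (N ∸ M) ⟨
    20201 ^ (M + (N ∸ M))                  ≡⟨ cong (20201 ^_) (m+[n∸m]≡n M≤N) ⟩
    20201 ^ N                              ∎)
    where
    open ≤-Reasoning
    20000≤20201 : 20000 ≤ 20201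
    20000≤20201 = ≤ᵇ⇒≤ 20000 20201 _

  -- For x ≤ a (n/d)^z with n/d ≤ g^ℓ, all denominators multiplied out. It serves for n/d = 42^42 /
  -- (21^21 14^14 6^6) and for n/d = 11/4.
  ≼-ratio : ∀ {x a n d L ℓ} .{{_ : NonZero d}} z → x * d ^ z ≤ a * n ^ z → n * 20000 ^ ℓ ≤ d * 20201 ^ ℓ →
    a ≼ L → x ≼ z * ℓ + L
  ≼-ratio {x} {a} {n} {d} {L} {ℓ} z xdᶻ≤anᶻ n≤dgˡ (mk≼ p) = mk≼ (*-cancelʳ-≤ _ _ (d ^ z) {{m^n≢0 d z}} (begin
    x * 20000 ^ (z * ℓ + L) * d ^ z                   ≡⟨ cong (λ t → x * t * d ^ z) (split 20000) ⟩
    x * ((20000 ^ ℓ) ^ z * 20000 ^ L) * d ^ z         ≡⟨ s₁ x ((20000 ^ ℓ) ^ z) (20000 ^ L) (d ^ z) ⟩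
    x * d ^ z * ((20000 ^ ℓ) ^ z * 20000 ^ L)         ≤⟨ *-monoˡ-≤ _ xdᶻ≤anᶻ ⟩
    a * n ^ z * ((20000 ^ ℓ) ^ z * 20000 ^ L)         ≡⟨ s₂ a (n ^ z) ((20000 ^ ℓ) ^ z) (20000 ^ L) ⟩
    n ^ z * (20000 ^ ℓ) ^ z * (a * 20000 ^ L)         ≡⟨ cong (_* (a * 20000 ^ L)) (^-distribʳ-* n (20000 ^ ℓ) z) ⟨
    (n * 20000 ^ ℓ) ^ z * (a * 20000 ^ L)             ≤⟨ *-mono-≤ (^-monoˡ-≤ z n≤dgˡ) p ⟩
    (d * 20201 ^ ℓ) ^ z * 20201 ^ L                   ≡⟨ cong (_* 20201 ^ L) (^-distribʳ-* d (20201 ^ ℓ) z) ⟩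
    d ^ z * (20201 ^ ℓ) ^ z * 20201 ^ L               ≡⟨ s₃ (d ^ z) ((20201 ^ ℓ) ^ z) (20201 ^ L) ⟩
    (20201 ^ ℓ) ^ z * 20201 ^ L * d ^ z               ≡⟨ cong (_* d ^ z) (split 20201) ⟨
    20201 ^ (z * ℓ + L) * d ^ z                       ∎))
    where
    open ≤-Reasoning
    split : ∀ b → b ^ (z * ℓ + L) ≡ (b ^ ℓ) ^ z * b ^ L
    split b = trans (^-distribˡ-+-* b (z * ℓ) L)
      (cong (_* b ^ L) (trans (cong (b ^_) (*-comm z ℓ)) (sym (^-*-assoc b ℓ z))))
    s₁ : ∀ x u v w → x * (u * v) * w ≡ x * w * (u * v)
    s₁ = solve-∀
    s₂ : ∀ a n u v → a * n * (u * v) ≡ n * u * (a * v)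
    s₂ = solve-∀
    s₃ : ∀ d u v → d * u * v ≡ u * v * d
    s₃ = solve-∀

  -- If k L exceeded N, then g^(kL) ≤ a^k ≤ g^N would contradict g > 1. This is the way back from a
  -- bound on a power to a bound on its exponent, by which a bound for π(y) is recovered from one
  -- for Y^π(y).
  ≼-reflects-≤ : ∀ {a L N} k → 20201 ^ L ≤ a * 20000 ^ L → a ^ k ≼ N → k * L ≤ N
  ≼-reflects-≤ {a} {L} {N} k gᴸ≤a (mk≼ p) with k * L ≤? N
  ... | yes kL≤N = kL≤N
  ... | no  kL≰N = contradiction (≤-trans (≤-reflexive (swap (20201 ^ N) (20000 ^ N) (20201 ^ e))) (≤-trans gᵏᴸ≤ (≤-reflexive (*-assoc (20201 ^ N) (20000 ^ N) (20000 ^ e)))))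
    (<⇒≱ (*-monoʳ-< (20201 ^ N) {{m^n≢0 20201 N}} (*-monoʳ-< (20000 ^ N) {{m^n≢0 20000 N}} (^-monoˡ-< e {{e≢0}} 20000<20201))))
    where
    open ≤-Reasoning
    e = k * L ∸ N
    e≢0 : NonZero e
    e≢0 = >-nonZero (m<n⇒0<n∸m (≰⇒> kL≰N))
    20000<20201 : 20000 < 20201
    20000<20201 = ≤ᵇ⇒≤ 20001 20201 _
    swap : ∀ a b c → a * (b * c) ≡ a * c * b
    swap = solve-∀
    s₁ : ∀ a b c → a * b * c ≡ a * c * b
    s₁ = solve-∀
    N+e : ∀ b → b ^ (k * L) ≡ b ^ N * b ^ e
    N+e b = trans (cong (b ^_) (sym (m+[n∸m]≡n (<⇒≤ (≰⇒> kL≰N))))) (^-distribˡ-+-* b N e)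
    power : ∀ b → (b ^ L) ^ k ≡ b ^ (k * L)
    power b = trans (^-*-assoc b L k) (cong (b ^_) (*-comm L k))
    gᵏᴸ≤ : 20201 ^ N * 20201 ^ e * 20000 ^ N ≤ 20201 ^ N * 20000 ^ N * 20000 ^ e
    gᵏᴸ≤ = begin
      20201 ^ N * 20201 ^ e * 20000 ^ N         ≡⟨ cong (_* 20000 ^ N) (trans (sym (N+e 20201)) (sym (power 20201))) ⟩
      (20201 ^ L) ^ k * 20000 ^ N               ≤⟨ *-monoˡ-≤ (20000 ^ N) (^-monoˡ-≤ k gᴸ≤a) ⟩
      (a * 20000 ^ L) ^ k * 20000 ^ N
        ≡⟨ cong (_* 20000 ^ N) (trans (^-distribʳ-* a (20000 ^ L) k) (cong (a ^ k *_) (power 20000))) ⟩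
      a ^ k * 20000 ^ (k * L) * 20000 ^ N       ≡⟨ s₁ (a ^ k) (20000 ^ (k * L)) (20000 ^ N) ⟩
      a ^ k * 20000 ^ N * 20000 ^ (k * L)       ≤⟨ *-monoˡ-≤ (20000 ^ (k * L)) p ⟩
      20201 ^ N * 20000 ^ (k * L)               ≡⟨ cong (20201 ^ N *_) (N+e 20000) ⟩
      20201 ^ N * (20000 ^ N * 20000 ^ e)       ≡⟨ *-assoc (20201 ^ N) (20000 ^ N) (20000 ^ e) ⟨
      20201 ^ N * 20000 ^ N * 20000 ^ e         ∎

  -- The quotients z^J / J! against powers of 11/4

  factorial≤ : ∀ {z} d J → d + J ≤ z → (d + J) ! ≤ J ! * z ^ d
  factorial≤ {z} zero    J _   = ≤-reflexive (sym (*-identityʳ (J !)))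
  factorial≤ {z} (suc d) J d<z = begin
    suc (d + J) * (d + J) !   ≤⟨ *-mono-≤ d<z (factorial≤ d J (<⇒≤ d<z)) ⟩
    z * (J ! * z ^ d)         ≡⟨ swap z (J !) (z ^ d) ⟩
    J ! * (z * z ^ d)         ∎
    where
    open ≤-Reasoning
    swap : ∀ z j e → z * (j * e) ≡ j * (z * e)
    swap = solve-∀

  factorial≥ : ∀ d z → z ^ d * z ! ≤ (d + z) !
  factorial≥ zero    z = ≤-reflexive (+-identityʳ (z !))
  factorial≥ (suc d) z = begin
    z * z ^ d * z !           ≡⟨ *-assoc z (z ^ d) (z !) ⟩
    z * (z ^ d * z !)         ≤⟨ *-mono-≤ (≤-trans (m≤n+m z d) (n≤1+n (d + z))) (factorial≥ d z) ⟩
    suc (d + z) * (d + z) !   ∎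
    where open ≤-Reasoning

  -- Among the numbers zᴶ / J! the one for J = z is the largest.
  z^J*z!≤z^z*J! : ∀ z J → z ^ J * z ! ≤ z ^ z * J !
  z^J*z!≤z^z*J! z J with ≤-total J z
  ... | inj₁ J≤z = begin
    z ^ J * z !                       ≡⟨ cong (λ k → z ^ J * k !) (m∸n+n≡m J≤z) ⟨
    z ^ J * (z ∸ J + J) !             ≤⟨ *-monoʳ-≤ (z ^ J) (factorial≤ (z ∸ J) J (≤-reflexive (m∸n+n≡m J≤z))) ⟩
    z ^ J * (J ! * z ^ (z ∸ J))       ≡⟨ swap (z ^ J) (J !) (z ^ (z ∸ J)) ⟩
    z ^ (z ∸ J) * z ^ J * J !         ≡⟨ cong (_* J !) (^-distribˡ-+-* z (z ∸ J) J) ⟨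
    z ^ (z ∸ J + J) * J !             ≡⟨ cong (λ k → z ^ k * J !) (m∸n+n≡m J≤z) ⟩
    z ^ z * J !                       ∎
    where
    open ≤-Reasoning
    swap : ∀ a b c → a * (b * c) ≡ c * a * b
    swap = solve-∀
  ... | inj₂ z≤J = begin
    z ^ J * z !                       ≡⟨ cong (λ k → z ^ k * z !) (m+[n∸m]≡n z≤J) ⟨
    z ^ (z + (J ∸ z)) * z !           ≡⟨ cong (_* z !) (^-distribˡ-+-* z z (J ∸ z)) ⟩
    z ^ z * z ^ (J ∸ z) * z !         ≡⟨ *-assoc (z ^ z) _ (z !) ⟩
    z ^ z * (z ^ (J ∸ z) * z !)       ≤⟨ *-monoʳ-≤ (z ^ z) (factorial≥ (J ∸ z) z) ⟩
    z ^ z * (J ∸ z + z) !             ≡⟨ cong (λ k → z ^ z * k !) (m∸n+n≡m z≤J) ⟩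
    z ^ z * J !                       ∎
    where open ≤-Reasoning

  -- Bernoulli's inequality for (1 + 1/u)^(j+1), multiplied by u^(j+1).
  bernoulli : ∀ u j → u ^ suc j + suc j * u ^ j ≤ suc u ^ suc j
  bernoulli u zero    = ≤-reflexive (base u)
    where
    base : ∀ u → u * 1 + 1 ≡ suc u * 1
    base = solve-∀
  bernoulli u (suc j) = begin
    u * (u * u ^ j) + suc (suc j) * (u * u ^ j)                          ≤⟨ m≤m+n _ (suc j * u ^ j) ⟩
    u * (u * u ^ j) + suc (suc j) * (u * u ^ j) + suc j * u ^ j          ≡⟨ step u j (u ^ j) ⟩
    suc u * (u * u ^ j + suc j * u ^ j)                                  ≤⟨ *-monoʳ-≤ (suc u) (bernoulli u j) ⟩
    suc u * suc u ^ suc j                                                ∎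
    where
    open ≤-Reasoning
    step : ∀ u j p → u * (u * p) + suc (suc j) * (u * p) + suc j * p ≡ suc u * (u * p + suc j * p)
    step = solve-∀

  -- (1 + 1/z)^(z+1) decreases with z: cross-multiplied, this is Bernoulli's inequality for (1 + 1/(z(z+2)))^(z+2).
  [1+1/z]^[1+z]-antitone : ∀ {α β} z .{{_ : NonZero z}} → α * suc z ^ suc z ≤ β * z ^ suc z →
    α * suc (suc z) ^ suc (suc z) ≤ β * suc z ^ suc (suc z)
  [1+1/z]^[1+z]-antitone {α} {β} z h = *-cancelʳ-≤ _ _ (z ^ k * suc z) {{m*n≢0 (z ^ k) (suc z) {{m^n≢0 z k}}}} (begin
    α * suc (suc z) ^ k * (z ^ k * suc z)                 ≡⟨ s₁ α (suc (suc z) ^ k) (z ^ k) (suc z) ⟩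
    α * (z ^ k * suc (suc z) ^ k * suc z)                 ≡⟨ cong (λ t → α * (t * suc z)) (^-distribʳ-* z (suc (suc z)) k) ⟨
    α * (u ^ k * suc z)                                   ≤⟨ *-monoʳ-≤ α core ⟩
    α * (suc u ^ k * z)
      ≡⟨ cong (λ t → α * (t * z)) (trans (cong (_^ k) (square z)) (^-distribʳ-* (suc z) (suc z) k)) ⟩
    α * (suc z ^ k * suc z ^ k * z)                       ≡⟨ s₂ α (suc z ^ k) (suc z ^ suc z) (suc z) z ⟩
    α * suc z ^ suc z * (suc z ^ k * suc z * z)           ≤⟨ *-monoˡ-≤ _ h ⟩
    β * z ^ suc z * (suc z ^ k * suc z * z)               ≡⟨ s₃ β (z ^ suc z) (suc z ^ k) (suc z) z ⟩
    β * suc z ^ k * (z ^ k * suc z)                       ∎)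
    where
    open ≤-Reasoning
    k = suc (suc z)
    u = z * suc (suc z)
    square : ∀ z → suc (z * suc (suc z)) ≡ suc z * suc z
    square = solve-∀
    s₁ : ∀ a b c d → a * b * (c * d) ≡ a * (c * b * d)
    s₁ = solve-∀
    s₂ : ∀ a s t y z → a * (s * (y * t) * z) ≡ a * t * (s * y * z)
    s₂ = solve-∀
    s₃ : ∀ b t s y z → b * t * (s * y * z) ≡ b * s * (z * t * y)
    s₃ = solve-∀
    regroup : ∀ z p → z * suc (suc z) * p * suc z ≡ (z * suc (suc z) * p + suc (suc z) * p) * z
    regroup = solve-∀
    core : u ^ k * suc z ≤ suc u ^ k * z
    core = ≤-trans (≤-reflexive (regroup z (u ^ suc z))) (*-monoˡ-≤ z (bernoulli u (suc z)))

  -- 11/4 serves as an upper bound for e.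
  4[1+1/z]^[1+z]≤11 : ∀ d → 4 * suc (d + 44) ^ suc (d + 44) ≤ 11 * (d + 44) ^ suc (d + 44)
  4[1+1/z]^[1+z]≤11 zero    = ≤ᵇ⇒≤ (4 * 45 ^ 45) (11 * 44 ^ 45) _
  4[1+1/z]^[1+z]≤11 (suc d) = [1+1/z]^[1+z]-antitone {4} {11} (d + 44) {{>-nonZero (≤-trans (s≤s z≤n) (m≤n+m 44 d))}} (4[1+1/z]^[1+z]≤11 d)

  -- From z to z + 1 the quotient z^z / z! grows by the factor (1 + 1/z)^z, which is less than (1 +
  -- 1/z)^(z+1). The latter decreases, so that its value at z = 44 bounds it from there on; for the
  -- increasing sequence (1 + 1/z)^z no single value would do.
  z^z≤z!*e^z : ∀ d → (d + 44) ^ (d + 44) * 4 ^ (d + 44) ≤ (d + 44) ! * 11 ^ (d + 44)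
  z^z≤z!*e^z zero    = ≤ᵇ⇒≤ (44 ^ 44 * 4 ^ 44) (44 ! * 11 ^ 44) _
  z^z≤z!*e^z (suc d) = begin
    suc z * suc z ^ z * (4 * 4 ^ z)          ≡⟨ s₁ (suc z) (suc z ^ z) (4 ^ z) ⟩
    4 * suc z ^ suc z * 4 ^ z                ≤⟨ *-monoˡ-≤ (4 ^ z) (4[1+1/z]^[1+z]≤11 d) ⟩
    11 * z ^ suc z * 4 ^ z                   ≤⟨ *-monoˡ-≤ (4 ^ z) (*-monoʳ-≤ 11 (*-monoˡ-≤ (z ^ z) (n≤1+n z))) ⟩
    11 * (suc z * z ^ z) * 4 ^ z             ≡⟨ s₂ (suc z) (z ^ z) (4 ^ z) ⟩
    11 * suc z * (z ^ z * 4 ^ z)             ≤⟨ *-monoʳ-≤ (11 * suc z) (z^z≤z!*e^z d) ⟩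
    11 * suc z * (z ! * 11 ^ z)              ≡⟨ s₃ (suc z) (z !) (11 ^ z) ⟩
    suc z * z ! * (11 * 11 ^ z)              ∎
    where
    open ≤-Reasoning
    z = d + 44
    s₁ : ∀ y p q → y * p * (4 * q) ≡ 4 * (y * p) * q
    s₁ = solve-∀
    s₂ : ∀ y p q → 11 * (y * p) * q ≡ 11 * y * (p * q)
    s₂ = solve-∀
    s₃ : ∀ y p q → 11 * y * (p * q) ≡ y * p * (11 * q)
    s₃ = solve-∀

  -- Stands for z^J / J! ≤ exp z, a single term against the exponential series. With 11/4 in place
  -- of e it goes through the largest term, J = z.
  z^J≤J!*e^z : ∀ {z} J → 44 ≤ z → z ^ J * 4 ^ z ≤ J ! * 11 ^ z
  z^J≤J!*e^z {z} J 44≤z = *-cancelʳ-≤ _ _ (z !) {{z !≢0}} (begin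
    z ^ J * 4 ^ z * z !      ≡⟨ s₁ (z ^ J) (4 ^ z) (z !) ⟩
    z ^ J * z ! * 4 ^ z      ≤⟨ *-monoˡ-≤ (4 ^ z) (z^J*z!≤z^z*J! z J) ⟩
    z ^ z * J ! * 4 ^ z      ≡⟨ s₁ (z ^ z) (J !) (4 ^ z) ⟩
    z ^ z * 4 ^ z * J !      ≤⟨ *-monoˡ-≤ (J !) (subst (λ z → z ^ z * 4 ^ z ≤ z ! * 11 ^ z) (m∸n+n≡m 44≤z) (z^z≤z!*e^z (z ∸ 44))) ⟩
    z ! * 11 ^ z * J !       ≡⟨ s₂ (z !) (11 ^ z) (J !) ⟩
    J ! * 11 ^ z * z !       ∎)
    where
    open ≤-Reasoning
    s₁ : ∀ a b c → a * b * c ≡ a * c * b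
    s₁ = solve-∀
    s₂ : ∀ a b c → a * b * c ≡ c * b * a
    s₂ = solve-∀

  -- The induction step for Y^π(y)

  π-prime : ∀ {t} → Prime (suc t) → π (suc t) ≡ suc (π t)
  π-prime pr = cong length (primesTo-prime pr)

  π-¬prime : ∀ {t} → ¬ Prime (suc t) → π (suc t) ≡ π t
  π-¬prime ¬pr = cong length (primesTo-¬prime ¬pr)

  primorial-prime : ∀ {t} → Prime (suc t) → primorial (suc t) ≡ suc t * primorial t
  primorial-prime pr = cong product (primesTo-prime pr)

  primorial-¬prime : ∀ {t} → ¬ Prime (suc t) → primorial (suc t) ≡ primorial t
  primorial-¬prime ¬pr = cong product (primesTo-¬prime ¬pr)

  π-0 : π 0 ≡ 0
  π-0 = cong length primesTo-0

  primorial-0 : primorial 0 ≡ 1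
  primorial-0 = cong product primesTo-0

  primorial≤primorial[1+t] : ∀ t → primorial t ≤ primorial (suc t)
  primorial≤primorial[1+t] t with prime? (suc t)
  ... | yes pr  = ≤-trans (m≤n*m (primorial t) (suc t)) (≤-reflexive (sym (primorial-prime pr)))
  ... | no  ¬pr = ≤-reflexive (sym (primorial-¬prime ¬pr))

  primorial-mono : ∀ {t u} → t ≤ u → primorial t ≤ primorial u
  primorial-mono {t} {u} t≤u = subst (λ v → primorial t ≤ primorial v) (m∸n+n≡m t≤u) (climb (u ∸ t))
    where
    climb : ∀ d → primorial t ≤ primorial (d + t)
    climb zero    = ≤-refl
    climb (suc d) = ≤-trans (climb d) (primorial≤primorial[1+t] (d + t))

  primorial≤^π : ∀ {t u} → t ≤ u → primorial t ≤ u ^ π t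
  primorial≤^π {zero}  {u} _   = ≤-reflexive (trans primorial-0 (cong (u ^_) (sym π-0)))
  primorial≤^π {suc t} {u} t<u with prime? (suc t)
  ... | yes pr  = begin
    primorial (suc t)    ≡⟨ primorial-prime pr ⟩
    suc t * primorial t  ≤⟨ *-mono-≤ t<u (primorial≤^π (<⇒≤ t<u)) ⟩
    u ^ suc (π t)        ≡⟨ cong (u ^_) (π-prime pr) ⟨
    u ^ π (suc t)        ∎
    where open ≤-Reasoning
  ... | no  ¬pr = begin
    primorial (suc t)    ≡⟨ primorial-¬prime ¬pr ⟩
    primorial t          ≤⟨ primorial≤^π (<⇒≤ t<u) ⟩
    u ^ π t              ≡⟨ cong (u ^_) (π-¬prime ¬pr) ⟨
    u ^ π (suc t)        ∎
    where open ≤-Reasoning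

  -- The k-th prime exceeds 8 (k - 60).
  π-linear⇒primorial≥ : ∀ t → (∀ {u} → u < t → π u * 8 ≤ u + 472) → (π t ∸ 60) ! * 8 ^ (π t ∸ 60) ≤ primorial t
  π-linear⇒primorial≥ zero    _ rewrite π-0 | primorial-0 = ≤-refl
  π-linear⇒primorial≥ (suc t) π≤ with prime? (suc t)
  ... | no  ¬pr rewrite π-¬prime ¬pr | primorial-¬prime ¬pr = π-linear⇒primorial≥ t (λ u<t → π≤ (m<n⇒m<1+n u<t))
  ... | yes pr  rewrite π-prime pr | primorial-prime pr with 60 ≤? π t
  ...   | yes 60≤π rewrite +-∸-assoc 1 60≤π = begin
    suc j * j ! * (8 * 8 ^ j)        ≡⟨ s₁ (suc j) (j !) (8 ^ j) ⟩
    suc j * 8 * (j ! * 8 ^ j)        ≤⟨ *-mono-≤ factor≤ (π-linear⇒primorial≥ t (λ u<t → π≤ (m<n⇒m<1+n u<t))) ⟩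
    suc t * primorial t              ∎
    where
    open ≤-Reasoning
    j = π t ∸ 60
    s₁ : ∀ a b c → a * b * (8 * c) ≡ a * 8 * (b * c)
    s₁ = solve-∀
    s₂ : ∀ j → suc j * 8 + 472 ≡ (j + 60) * 8
    s₂ = solve-∀
    factor≤ : suc j * 8 ≤ suc t
    factor≤ = ≤-trans (+-cancelʳ-≤ 472 (suc j * 8) t (begin
      suc j * 8 + 472      ≡⟨ s₂ j ⟩
      (j + 60) * 8         ≡⟨ cong (_* 8) (m∸n+n≡m 60≤π) ⟩
      π t * 8              ≤⟨ π≤ ≤-refl ⟩
      t + 472              ∎)) (n≤1+n t)
  ...   | no  60≰π rewrite m≤n⇒m∸n≡0 (≰⇒> 60≰π) = begin
    1                                   ≤⟨ s≤s z≤n ⟩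
    suc t                               ≡⟨ *-identityʳ (suc t) ⟨
    suc t * 1                           ≡⟨ cong (λ k → suc t * (k ! * 8 ^ k)) (m≤n⇒m∸n≡0 {n = 60} (<⇒≤ (≰⇒> 60≰π))) ⟨
    suc t * ((π t ∸ 60) ! * 8 ^ (π t ∸ 60)) ≤⟨ *-monoʳ-≤ (suc t) (π-linear⇒primorial≥ t (λ u<t → π≤ (m<n⇒m<1+n u<t))) ⟩
    suc t * primorial t                 ∎
    where open ≤-Reasoning

  -- 100 log (42^42 / (21^21 14^14 6^6)) is about 4535.05.
  multinomial≼ : ∀ m M → (m * 42) ! ≡ M * ((m * 21) ! * (m * 14) ! * (m * 6) ! * m !) → M ≼ m * 4536
  multinomial≼ m M eq = ≼-mono ≤-refl (≤-reflexive (+-identityʳ (m * 4536)))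
    (≼-ratio {M} {1} {42 ^ 42} {21 ^ 21 * 14 ^ 14 * 6 ^ 6} {0} {4536} m ratio (≤ᵇ⇒≤ (42 ^ 42 * 20000 ^ 4536) (21 ^ 21 * 14 ^ 14 * 6 ^ 6 * 20201 ^ 4536) _) ≼-1)
    where
    open ≤-Reasoning
    power : ∀ b → b ^ (m * b) ≡ (b ^ b) ^ m
    power b = trans (cong (b ^_) (*-comm m b)) (sym (^-*-assoc b b m))
    ratio : M * (21 ^ 21 * 14 ^ 14 * 6 ^ 6) ^ m ≤ 1 * (42 ^ 42) ^ m
    ratio = begin
      M * (21 ^ 21 * 14 ^ 14 * 6 ^ 6) ^ m
        ≡⟨ cong (M *_) (trans (^-distribʳ-* (21 ^ 21 * 14 ^ 14) (6 ^ 6) m) (cong (_* (6 ^ 6) ^ m) (^-distribʳ-* (21 ^ 21) (14 ^ 14) m))) ⟩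
      M * ((21 ^ 21) ^ m * (14 ^ 14) ^ m * (6 ^ 6) ^ m)     ≡⟨ cong (M *_) (cong₂ _*_ (cong₂ _*_ (power 21) (power 14)) (power 6)) ⟨
      M * (21 ^ (m * 21) * 14 ^ (m * 14) * 6 ^ (m * 6))     ≤⟨ multinomial≤ m M eq ⟩
      42 ^ (m * 42)                                         ≡⟨ trans (power 42) (sym (*-identityˡ ((42 ^ 42) ^ m))) ⟩
      1 * (42 ^ 42) ^ m                                     ∎

  -- The base is y + 1 because n can be as large as (y + 1)². The rate 125/100 is half of 5/2, since
  -- squaring y + 1 doubles the exponent.
  PrimeBound : ℕ → Set
  PrimeBound y = suc y ^ π y ≼ y * 125

  1+s≤2^s : ∀ s → suc s ≤ 2 ^ s
  1+s≤2^s zero    = ≤-refl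
  1+s≤2^s (suc s) = begin
    suc (suc s)             ≤⟨ s≤s (m≤n+m (suc s) s) ⟩
    suc s + suc s           ≡⟨ cong (suc s +_) (sym (+-identityʳ (suc s))) ⟩
    2 * suc s               ≤⟨ *-monoʳ-≤ 2 (1+s≤2^s s) ⟩
    2 * 2 ^ s               ∎
    where open ≤-Reasoning

  m<[1+m/n]*n : ∀ m n .{{_ : NonZero n}} → m < suc (m / n) * n
  m<[1+m/n]*n m n = begin-strict
    m                        ≡⟨ m≡m%n+[m/n]*n m n ⟩
    m % n + m / n * n        <⟨ +-monoˡ-< (m / n * n) (m%n<n m n) ⟩
    n + m / n * n            ∎
    where open ≤-Reasoning

  -- For a mere 60 factors a linear majorant of the logarithm is good enough: with s = ⌊y/65536⌋, y
  -- + 1 ≤ (s + 1) 65536 ≤ 2^s 65536. The constants round up 100 log 2 = 69.3... and 100 log 65536 =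
  -- 1109.0....
  ≼-logarithmic : ∀ y → suc y ≼ y / 65536 * 70 + 1110
  ≼-logarithmic y = ≼-mono (≤-trans (m<[1+m/n]*n y 65536) (*-monoˡ-≤ 65536 (1+s≤2^s (y / 65536))))
    ≤-refl (≼-* (≼-^ (y / 65536) (≼-compute 2 70 _)) (≼-compute 65536 1110 _))

  -- The witness ⌊y/k⌋ + 1 is one more than the ceiling when k divides y; the allowance y + k covers
  -- this.
  ceiling : ∀ y k .{{_ : NonZero k}} → ∃[ m ] (y ≤ m * k × m * k ≤ y + k)
  ceiling y k = suc (y / k) , <⇒≤ (m<[1+m/n]*n y k) ,
    ≤-trans (+-monoʳ-≤ k (m/n*n≤m y k)) (≤-reflexive (+-comm k y))

  -- 168 is the least common multiple of 42 and 8.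
  exponent-arithmetic : ∀ {y m z s} → 65536 ≤ y → 1 ≤ s → s * 65536 ≤ y → m * 42 ≤ y + 42 → z * 8 ≤ y + 9 →
    z * 102 + (60 * (s * 70 + 1110) + (m * 4536 + m * 125)) ≤ y * 125
  exponent-arithmetic {y} {m} {z} {s} y≥ 1≤s s≤ m≤ z≤ = *-cancelʳ-≤ _ _ 168 (begin
    (z * 102 + (60 * (s * 70 + 1110) + (m * 4536 + m * 125))) * 168
       ≡⟨ expand 102 60 1110 70 4536 125 168 z s m ⟩
    z * (8 * 2142) + 11188800 + s * 705600 + m * (42 * 18644)
       ≡⟨ cong₂ (λ u v → u + 11188800 + s * 705600 + v) (*-assoc z 8 2142) (*-assoc m 42 18644) ⟨
    z * 8 * 2142 + 11188800 + s * 705600 + m * 42 * 18644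
       ≤⟨ +-mono-≤ (+-monoˡ-≤ (s * 705600) (+-monoˡ-≤ 11188800 (*-monoˡ-≤ 2142 z≤))) (*-monoˡ-≤ 18644 m≤) ⟩
    (y + 9) * 2142 + 11188800 + s * 705600 + (y + 42) * 18644
       ≡⟨ collect 9 2142 11188800 705600 42 18644 y s ⟩
    s * 705600 + 11991126 + y * 20786
       ≤⟨ +-monoˡ-≤ (y * 20786) (+-monoʳ-≤ (s * 705600) (m≤n*m 11991126 s {{>-nonZero 1≤s}})) ⟩
    s * 705600 + s * 11991126 + y * 20786
       ≡⟨ cong (_+ y * 20786) (*-distribˡ-+ s 705600 11991126) ⟨
    s * 12696726 + y * 20786
       -- The difference 214 = 125 · 168 - 20786 is the slope left for the constants and the
       -- logarithmic term, which have been collected into 12696726 s. That 65536 · 214 = 14024704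
       -- exceeds this coefficient is what lets the induction start at 65536.
       ≤⟨ +-monoˡ-≤ (y * 20786) (*-monoʳ-≤ s (≤ᵇ⇒≤ 12696726 14024704 _)) ⟩
    s * (65536 * 214) + y * 20786
       ≡⟨ cong (_+ y * 20786) (*-assoc s 65536 214) ⟨
    s * 65536 * 214 + y * 20786
       ≤⟨ +-monoˡ-≤ (y * 20786) (*-monoˡ-≤ 214 s≤) ⟩
    y * 214 + y * 20786
       ≡⟨ *-distribˡ-+ y 214 20786 ⟨
    y * (125 * 168)
       ≡⟨ *-assoc y 125 168 ⟨
    y * 125 * 168  ∎)
    where
    open ≤-Reasoning
    expand : ∀ a b c d e f k z s m → (z * a + (b * (s * d + c) + (m * e + m * f))) * k ≡
      z * (a * k) + b * c * k + s * (b * d * k) + m * ((e + f) * k)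
    expand = solve-∀
    collect : ∀ a b c d e f y s → (y + a) * b + c + s * d + (y + e) * f ≡
      s * d + (a * b + c + e * f) + y * (b + f)
    collect = solve-∀

  primorial≼ : ∀ m → PrimeBound m → primorial (m * 42) ≼ m * 4536 + m * 125
  primorial≼ m pb = bound (multinomial-exists m)
    where
    bound : ∃[ M ] ((m * 42) ! ≡ M * ((m * 21) ! * (m * 14) ! * (m * 6) ! * m !)) → primorial (m * 42) ≼ m * 4536 + m * 125
    bound (M , eq) = ≼-mono (≤-trans (primorial-42≤ m M eq) (*-monoʳ-≤ M (primorial≤^π (n≤1+n m)))) ≤-refl
      (≼-* (multinomial≼ m M eq) pb)

  -- Bounds the product of the Y/p when P is the primorial: C factors are estimated by Y alone, and
  -- for the J others Y^J ≤ 8^J z^J ≤ 8^J J! e^z ≤ P e^z, with 11/4 for e.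
  power-π≤ : ∀ {Y k P z} C → 0 < Y → Y ≤ z * 8 → 44 ≤ z → (k ∸ C) ! * 8 ^ (k ∸ C) ≤ P →
    Y ^ k * 4 ^ z ≤ Y ^ C * P * 11 ^ z
  power-π≤ {Y} {k} {P} {z} C 0<Y Y≤8z 44≤z J!8ᴶ≤P = begin
      Y ^ k * 4 ^ z                           ≤⟨ *-monoˡ-≤ (4 ^ z) (^-monoʳ-≤ Y {{>-nonZero 0<Y}} (m≤n+m∸n k C)) ⟩
      Y ^ (C + J) * 4 ^ z                     ≡⟨ cong (_* 4 ^ z) (^-distribˡ-+-* Y C J) ⟩
      Y ^ C * Y ^ J * 4 ^ z                   ≤⟨ *-monoˡ-≤ (4 ^ z) (*-monoʳ-≤ (Y ^ C) (^-monoˡ-≤ J Y≤8z)) ⟩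
      Y ^ C * (z * 8) ^ J * 4 ^ z             ≡⟨ cong (λ t → Y ^ C * t * 4 ^ z) (^-distribʳ-* z 8 J) ⟩
      Y ^ C * (z ^ J * 8 ^ J) * 4 ^ z         ≡⟨ s₁ (Y ^ C) (8 ^ J) (z ^ J) (4 ^ z) ⟩
      Y ^ C * (8 ^ J * (z ^ J * 4 ^ z))       ≤⟨ *-monoʳ-≤ (Y ^ C) (*-monoʳ-≤ (8 ^ J) (z^J≤J!*e^z J 44≤z)) ⟩
      Y ^ C * (8 ^ J * (J ! * 11 ^ z))        ≡⟨ s₂ (Y ^ C) (8 ^ J) (J !) (11 ^ z) ⟩
      Y ^ C * (J ! * 8 ^ J) * 11 ^ z          ≤⟨ *-monoˡ-≤ (11 ^ z) (*-monoʳ-≤ (Y ^ C) J!8ᴶ≤P) ⟩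
      Y ^ C * P * 11 ^ z                      ∎
    where
    open ≤-Reasoning
    J = k ∸ C
    s₁ : ∀ a b c d → a * (c * b) * d ≡ a * (b * (c * d))
    s₁ = solve-∀
    s₂ : ∀ a b c d → a * (b * (c * d)) ≡ a * (c * b) * d
    s₂ = solve-∀

  primeBound-step : ∀ y → 65536 ≤ y → (∀ {u} → u < y → π u * 8 ≤ u + 472) →
    (∀ m → y ≤ m * 42 → m * 42 ≤ y + 42 → PrimeBound m) → PrimeBound y
  primeBound-step y y≥ π≤ ih = combine (ceiling y 42) (ceiling (suc y) 8)
    where
    combine : ∃[ m ] (y ≤ m * 42 × m * 42 ≤ y + 42) → ∃[ z ] (suc y ≤ z * 8 × z * 8 ≤ suc y + 8) → PrimeBound y
    combine (m , y≤42m , 42m≤) (z , Y≤8z , 8z≤) =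
      ≼-mono ≤-refl (exponent-arithmetic {y} {m} {z} {y / 65536} y≥ (m≥n⇒m/n>0 y≥) (m/n*n≤m y 65536) 42m≤ (≤-trans 8z≤ (≤-reflexive (sym (+-suc y 8)))))
        (≼-ratio {suc y ^ π y} {suc y ^ 60 * primorial y} {11} {4} {60 * L + N} {102} z
          (power-π≤ {suc y} {π y} {primorial y} {z} 60 (s≤s z≤n) Y≤8z 44≤z (π-linear⇒primorial≥ y π≤))
          -- The exponent 102 rounds up 100 log (11/4) = 101.1...; per unit of y this costs 102/8 =
          -- 12.75 instead of the ideal 12.5.
          (≤ᵇ⇒≤ (11 * 20000 ^ 102) (4 * 20201 ^ 102) _) (≼-* {suc y ^ 60} {primorial y} {60 * L} {N} Y⁶⁰≼ P≼))
      where
      44≤z : 44 ≤ z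
      44≤z = *-cancelʳ-≤ 44 z 8 (≤-trans (≤-trans (≤ᵇ⇒≤ 352 65536 _) y≥) (≤-trans (n≤1+n y) Y≤8z))
      L = y / 65536 * 70 + 1110
      N = m * 4536 + m * 125
      Y⁶⁰≼ : suc y ^ 60 ≼ 60 * L
      Y⁶⁰≼ = ≼-^ {suc y} {L} 60 (≼-logarithmic y)
      P≼ : primorial y ≼ N
      P≼ = ≼-mono {primorial y} {primorial (m * 42)} {N} {N} (primorial-mono y≤42m) ≤-refl (primorial≼ m (ih m y≤42m 42m≤))

  -- The sieve below 65536

  trialDivision : List ℕ → ℕ → Bool
  trialDivision (d@(suc (suc _)) ∷ ds) t =
    if t <ᵇ d * d then true else if t % d ≡ᵇ 0 then false else trialDivision ds t
  trialDivision _ t = true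

  -- One direction is enough: the count built on this test has to bound π from above, and a
  -- composite number that passes only raises it.
  prime⇒trialDivision : ∀ ds {t} → Prime t → T (trialDivision ds t)
  prime⇒trialDivision [] _ = _
  prime⇒trialDivision (zero ∷ ds) _ = _
  prime⇒trialDivision (suc zero ∷ ds) _ = _
  prime⇒trialDivision (d@(suc (suc _)) ∷ ds) {t} pr with t <ᵇ d * d in t<d² | t % d ≡ᵇ 0 in t%d
  ... | true  | _     = _
  ... | false | false = prime⇒trialDivision ds pr
  ... | false | true with prime⇒irreducible pr (m%n≡0⇒n∣m t d (≡ᵇ⇒≡ (t % d) 0 (subst T (sym t%d) _)))
  -- The divisor d cannot be t itself, for then t < d² and the first test would have succeeded.
  ...   | inj₂ refl = subst T t<d² (<⇒<ᵇ (m<m*n t t {{prime⇒nonZero pr}} (s≤s (s≤s z≤n))))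

  smallPrimes : List ℕ
  smallPrimes =
    2 ∷ 3 ∷ 5 ∷ 7 ∷ 11 ∷ 13 ∷ 17 ∷ 19 ∷ 23 ∷ 29 ∷ 31 ∷ 37 ∷ 41 ∷ 43 ∷ 47 ∷ 53 ∷ 59 ∷ 61 ∷ 67 ∷ 71 ∷
    73 ∷ 79 ∷ 83 ∷ 89 ∷ 97 ∷ 101 ∷ 103 ∷ 107 ∷ 109 ∷ 113 ∷ 127 ∷ 131 ∷ 137 ∷ 139 ∷ 149 ∷ 151 ∷ 157 ∷
    163 ∷ 167 ∷ 173 ∷ 179 ∷ 181 ∷ 191 ∷ 193 ∷ 197 ∷ 199 ∷ 211 ∷ 223 ∷ 227 ∷ 229 ∷ 233 ∷ 239 ∷ 241 ∷
    251 ∷ []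

  possiblyPrime : ℕ → Bool
  possiblyPrime t = (1 <ᵇ t) ∧ trialDivision smallPrimes t

  prime⇒possiblyPrime : ∀ {t} → Prime t → T (possiblyPrime t)
  prime⇒possiblyPrime pr = Equivalence.from T-∧ (<⇒<ᵇ (nonTrivial⇒n>1 _ {{prime⇒nonTrivial pr}}) , prime⇒trialDivision smallPrimes pr)

  nextCount : ℕ → ℕ → ℕ
  nextCount t k = if possiblyPrime t then suc k else k

  π≤nextCount : ∀ {t k} → π t ≤ k → π (suc t) ≤ nextCount (suc t) k
  π≤nextCount {t} {k} π≤k with prime? (suc t)
  ... | yes pr with possiblyPrime (suc t) | prime⇒possiblyPrime pr
  ...   | true | _ = ≤-trans (≤-reflexive (π-prime pr)) (s≤s π≤k)
  π≤nextCount {t} {k} π≤k | no ¬pr with possiblyPrime (suc t)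
  ...   | true  = ≤-trans (≤-reflexive (π-¬prime ¬pr)) (m≤n⇒m≤1+n π≤k)
  ...   | false = ≤-trans (≤-reflexive (π-¬prime ¬pr)) π≤k

  -- The values at which PrimeBound fails.
  exceptions : List ℕ
  exceptions = 19 ∷ 109 ∷ 113 ∷ []

  data Bounded (t : ℕ) : Set where
    regular     : PrimeBound t → Bounded t
    exceptional : t ∈ exceptions → suc t ^ pred (π t) ≼ t * 125 → Bounded t

  Linear : ℕ → Set
  Linear t = π t * 8 ≤ t + 472

  _∈ᵇ_ : ℕ → List ℕ → Bool
  t ∈ᵇ []       = false
  t ∈ᵇ (x ∷ xs) = (t ≡ᵇ x) ∨ (t ∈ᵇ xs)

  ∈ᵇ⇒∈ : ∀ t xs → T (t ∈ᵇ xs) → t ∈ xs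
  ∈ᵇ⇒∈ t (x ∷ xs) h with Equivalence.to (T-∨ {t ≡ᵇ x}) h
  ... | inj₁ t≡x = here (≡ᵇ⇒≡ t x t≡x)
  ... | inj₂ t∈  = there (∈ᵇ⇒∈ t xs t∈)

  check : ℕ → ℕ → ℕ → Bool
  check t k ℓ = (k * 8 ≤ᵇ t + 472) ∧ ((k * ℓ ≤ᵇ t * 125) ∨ ((t ∈ᵇ exceptions) ∧ (pred k * ℓ ≤ᵇ t * 125)))

  power≼ : ∀ {Y j k ℓ N} → j ≤ k → Y ≼ ℓ → k * ℓ ≤ N → Y ^ j ≼ N
  power≼ {Y} {j} {k} {ℓ} j≤k Y≼ℓ kℓ≤N = ≼-mono ≤-refl (≤-trans (*-monoˡ-≤ ℓ j≤k) kℓ≤N) (≼-^ {Y} {ℓ} j Y≼ℓ)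

  check-sound : ∀ {t k ℓ} → π t ≤ k → suc t ≼ ℓ → T (check t k ℓ) → Linear t × Bounded t
  check-sound {t} {k} {ℓ} π≤k Y≼ℓ h
    with lin , h′ ← Equivalence.to (T-∧ {k * 8 ≤ᵇ t + 472}) h
    with Equivalence.to (T-∨ {k * ℓ ≤ᵇ t * 125}) h′
  ... | inj₁ reg = ≤-trans (*-monoˡ-≤ 8 π≤k) (≤ᵇ⇒≤ (k * 8) (t + 472) lin) ,
                   regular (power≼ π≤k Y≼ℓ (≤ᵇ⇒≤ (k * ℓ) (t * 125) reg))
  ... | inj₂ exc with t∈ , b ← Equivalence.to (T-∧ {t ∈ᵇ exceptions}) exc =
                   ≤-trans (*-monoˡ-≤ 8 π≤k) (≤ᵇ⇒≤ (k * 8) (t + 472) lin) ,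
                   exceptional (∈ᵇ⇒∈ t exceptions t∈) (power≼ (pred-mono-≤ π≤k) Y≼ℓ (≤ᵇ⇒≤ (pred k * ℓ) (t * 125) b))

  -- One ℓ serves a whole segment, so the large powers of 20000 and 20201 are compared once per
  -- segment and each t costs only a product of small numbers. The count k reaches the next segment
  -- through `continue`.
  scanSegment : ℕ → ℕ → ℕ → ℕ → (ℕ → ℕ → Bool) → Bool
  scanSegment zero    t k ℓ continue = continue t k
  scanSegment (suc n) t k ℓ continue = check t k ℓ ∧ scanSegment n (suc t) (nextCount (suc t) k) ℓ continue

  scan : List (ℕ × ℕ) → ℕ → ℕ → Bool
  scan []             t k = true
  scan ((n , ℓ) ∷ ss) t k = ((t + n) * 20000 ^ ℓ ≤ᵇ 20201 ^ ℓ) ∧ scanSegment n t k ℓ (scan ss)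

  total : List (ℕ × ℕ) → ℕ
  total []             = 0
  total ((n , _) ∷ ss) = n + total ss

  Sound : (ℕ → ℕ → Bool) → ℕ → Set
  Sound c len = ∀ t k → T (c t k) → π t ≤ k → ∀ u → t ≤ u → u < t + len → Linear u × Bounded u

  scanSegment-sound : ∀ {c len} n {ℓ} t k → Sound c len → t + n ≼ ℓ → T (scanSegment n t k ℓ c) → π t ≤ k →
    ∀ u → t ≤ u → u < t + (n + len) → Linear u × Bounded u
  scanSegment-sound zero    t k sound _ h π≤k u t≤u u< = sound t k h π≤k u t≤u u<
  scanSegment-sound {c} {len} (suc n) {ℓ} t k sound t+n≼ℓ h π≤k u t≤u u<
    with now , later ← Equivalence.to (T-∧ {check t k ℓ}) h | m≤n⇒m<n∨m≡n t≤u
  ... | inj₂ refl = check-sound π≤k (≼-mono (≤-trans (s≤s (m≤m+n t n)) (≤-reflexive (sym (+-suc t n)))) ≤-refl t+n≼ℓ) now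
  ... | inj₁ t<u  = scanSegment-sound n (suc t) (nextCount (suc t) k) sound
    (subst (_≼ ℓ) (+-suc t n) t+n≼ℓ) later (π≤nextCount π≤k) u t<u (subst (u <_) (+-suc t (n + len)) u<)

  scan-sound : ∀ ss → Sound (scan ss) (total ss)
  scan-sound []             t k h π≤k u t≤u u< = contradiction (≤-trans u< (≤-reflexive (+-identityʳ t))) (≤⇒≯ t≤u)
  scan-sound ((n , ℓ) ∷ ss) t k h π≤k u t≤u u< with t+n≼ℓ , h′ ← Equivalence.to (T-∧ {(t + n) * 20000 ^ ℓ ≤ᵇ 20201 ^ ℓ}) h =
    scanSegment-sound n t k (scan-sound ss) (≼-compute (t + n) ℓ t+n≼ℓ) h′ π≤k u t≤u u<

  -- An entry (n , ℓ) treats the next n integers t, for all of which 100 log (t + 1) is at most about ℓ.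
  segments : List (ℕ × ℕ)
  segments =
    (6 , 180) ∷ (2 , 208) ∷ (4 , 249) ∷ (2 , 264) ∷ (4 , 290) ∷ (4 , 310) ∷ (2 , 318) ∷ (3 , 330) ∷
    (6 , 350) ∷ (9 , 374) ∷ (4 , 383) ∷ (3 , 390) ∷ (10 , 408) ∷ (9 , 422) ∷ (8 , 434) ∷ (12 , 448) ∷
    (14 , 463) ∷ (12 , 474) ∷ (1 , 475) ∷ (5 , 479) ∷ (28 , 500) ∷ (40 , 524) ∷ (33 , 540) ∷
    (71 , 568) ∷ (73 , 590) ∷ (168 , 628) ∷ (295 , 672) ∷ (433 , 714) ∷ (797 , 763) ∷ (1807 , 826) ∷
    (4156 , 899) ∷ (12308 , 992) ∷ (42603 , 1105) ∷ (2604 , 1110) ∷ []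

  bounded-small : ∀ u → u < 65536 → Linear u × Bounded u
  bounded-small u u< = scan-sound segments 0 0 _ (≤-reflexive π-0) u z≤n u<

  -- The two halves need each other: from 65536 on, `PrimeBound y` rests on `Linear` at all u < y
  -- and on `PrimeBound` at one m near y/42, and in turn yields `Linear y`.
  bounded : ∀ y → Linear y × Bounded y
  bounded = <-rec _ go
    where
    large : ∀ y → 65536 ≤ y → (∀ {u} → u < y → Linear u × Bounded u) → PrimeBound y
    large y y≥ ih = primeBound-step y y≥ (proj₁ ∘ ih) (λ m y≤42m 42m≤ → notExceptional m y≤42m (proj₂ (ih (m<y m 42m≤))))
      where
      m<y : ∀ m → m * 42 ≤ y + 42 → m < y
      -- If y ≤ m, then 41 m ≤ 42 although m ≥ 65536; `≤⇒≤ᵇ` makes the false inequality 65536 · 41 ≤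
      -- 42 evaluate to the empty type.
      m<y m 42m≤ = ≰⇒> λ y≤m → ≤⇒≤ᵇ (≤-trans (*-monoˡ-≤ 41 (≤-trans y≥ y≤m)) (+-cancelˡ-≤ m (m * 41) 42 (begin
        m + m * 41     ≡⟨ *-suc m 41 ⟨
        m * 42         ≤⟨ 42m≤ ⟩
        y + 42         ≤⟨ +-monoˡ-≤ 42 y≤m ⟩
        m + 42         ∎)))
        where open ≤-Reasoning
      notExceptional : ∀ m → y ≤ m * 42 → Bounded m → PrimeBound m
      notExceptional m _     (regular pb) = pb
      -- Exceptions never enter the induction: 42 m ≥ 65536 here, but the largest of them gives 42 ·
      -- 113 = 4746.
      notExceptional m y≤42m (exceptional m∈ _) = contradiction (≤-trans y≥ y≤42m) (<⇒≱ (small m m∈))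
        where
        small : ∀ m → m ∈ exceptions → m * 42 < 65536
        small m m∈ = All.lookup {P = λ m → m * 42 < 65536} (from-yes (All.all? (λ m → m * 42 <? 65536) exceptions)) m∈
    linear : ∀ y → 65536 ≤ y → PrimeBound y → Linear y
    linear y y≥ pb = ≤-trans (*-cancelʳ-≤ (π y * 8) y 125 (≤-trans (≤-reflexive (*-assoc (π y) 8 125)) 1000π≤)) (m≤m+n y 472)
      where
      65536^π≼ : 65536 ^ π y ≼ y * 125
      65536^π≼ = ≼-mono (^-monoˡ-≤ (π y) (m≤n⇒m≤1+n y≥)) ≤-refl pb
      1000π≤ : π y * 1000 ≤ y * 125
      -- g^1000 is less than exp 10, and 65536 = exp 11.09.... Since 1000 = 8 · 125, this is where
      -- the slope 1/8 comes from.
      1000π≤ = ≼-reflects-≤ {65536} {1000} {y * 125} (π y) (≤ᵇ⇒≤ (20201 ^ 1000) (65536 * 20000 ^ 1000) _) 65536^π≼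
    go : ∀ y → (∀ {u} → u < y → Linear u × Bounded u) → Linear y × Bounded y
    go y ih with y <? 65536
    ... | yes y<  = bounded-small y y<
    ... | no  y≮  = linear y (≮⇒≥ y≮) (large y (≮⇒≥ y≮) ih) , regular (large y (≮⇒≥ y≮) ih)

  -- The primes of 𝔭⁻ and the exceptional values

  smallPrimeDivisors : ℕ → List ℕ
  smallPrimeDivisors n = filter (λ p → prime? p ×-dec (p * p <? n) ×-dec (p ≤? s p n)) (upTo (suc n))

  ω-𝔭⁻ : ∀ n → ω (𝔭⁻ n) ≡ length (smallPrimeDivisors n)
  ω-𝔭⁻ n = ω-product-filter (λ p → (p * p <? n) ×-dec (p ≤? s p n)) (suc n)

  module _ {n y : ℕ} (n≤ : n ≤ suc y * suc y) where

    private
      P? = λ p → prime? p ×-dec (p * p <? n) ×-dec (p ≤? s p n)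

      ps-unique : Unique (smallPrimeDivisors n)
      ps-unique = filter⁺ P? (upTo⁺ (suc n))

      ∈⇒ : ∀ {p} → p ∈ smallPrimeDivisors n → Prime p × p ≤ y × p ≤ s p n
      ∈⇒ p∈ with _ , pr , p²<n , p≤s ← ∈-filter⁻ P? {xs = upTo (suc n)} p∈ =
        pr , ≤-pred (≰⇒> λ y<p → <⇒≱ (<-≤-trans p²<n n≤) (*-mono-≤ y<p y<p)) , p≤s

      ∈⇒∈-primesTo : ∀ {p} → p ∈ smallPrimeDivisors n → p ∈ primesTo y
      ∈⇒∈-primesTo p∈ = ∈-primesTo (proj₁ (∈⇒ p∈)) (proj₁ (proj₂ (∈⇒ p∈)))

    ω-𝔭⁻≤π : ω (𝔭⁻ n) ≤ π y
    ω-𝔭⁻≤π = ≤-trans (≤-reflexive (ω-𝔭⁻ n)) (length-⊆ ps-unique ∈⇒∈-primesTo)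

    ω-𝔭⁻<π : ∀ {q} → Prime q → q ≤ y → s q n < q → ω (𝔭⁻ n) < π y
    ω-𝔭⁻<π {q} pr q≤y s<q = ≤-trans (s≤s (≤-reflexive (ω-𝔭⁻ n)))
      (length-⊆ (¬Any⇒All¬ _ (λ q∈ → <⇒≱ s<q (proj₂ (proj₂ (∈⇒ q∈)))) ∷ ps-unique)
        λ { (here refl) → ∈-primesTo pr q≤y ; (there p∈) → ∈⇒∈-primesTo p∈ })

  -- The numbers y² + 1 + i with i ≤ 2y are exactly the n with y² < n ≤ (y + 1)².
  HasMissingPrime : ℕ → List ℕ → Set
  HasMissingPrime y qs = All (λ q → Prime q × q ≤ y) qs × (∀ {i} → i < suc (2 * y) → Any (λ q → s q (suc (y * y) + i) < q) qs)

  missingPrime? : ∀ y qs → Dec (HasMissingPrime y qs)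
  missingPrime? y qs = all? (λ q → prime? q ×-dec (q ≤? y)) qs ×-dec allUpTo? (λ i → any? (λ q → s q (suc (y * y) + i) <? q) qs) (suc (2 * y))

  -- All three exceptions y are primes. In base y the digits of n are a leading 1 and those of n -
  -- y² ≤ 2y + 1, so the digit sum reaches y only at y² + y - 1, y² + 2y - 2 and y² + 2y - 1. The
  -- second prime of the list takes care of these.
  missing-19 : HasMissingPrime 19 (19 ∷ 17 ∷ [])
  missing-19 = from-yes (missingPrime? 19 (19 ∷ 17 ∷ []))
  missing-109 : HasMissingPrime 109 (109 ∷ 107 ∷ [])
  missing-109 = from-yes (missingPrime? 109 (109 ∷ 107 ∷ []))
  missing-113 : HasMissingPrime 113 (113 ∷ 109 ∷ [])
  missing-113 = from-yes (missingPrime? 113 (113 ∷ 109 ∷ []))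

  HasMissingPrime⇒ω-𝔭⁻<π : ∀ {y qs n} → HasMissingPrime y qs → y * y < n → n ≤ suc y * suc y → ω (𝔭⁻ n) < π y
  HasMissingPrime⇒ω-𝔭⁻<π {y} {qs} {n} (good , missing) y²<n n≤ =
    let q , q∈ , s<q = find (missing i<)
        pr , q≤y     = All.lookup good q∈
    in ω-𝔭⁻<π n≤ pr q≤y (subst (λ m → s q m < q) n≡ s<q)
    where
    n≡ : suc (y * y) + (n ∸ suc (y * y)) ≡ n
    n≡ = m+[n∸m]≡n y²<n
    square : ∀ y → suc y * suc y ≡ suc (y * y) + 2 * y
    square = solve-∀
    i< : n ∸ suc (y * y) < suc (2 * y)
    i< = s≤s (+-cancelˡ-≤ (suc (y * y)) _ _ (≤-trans (≤-reflexive n≡) (≤-trans n≤ (≤-reflexive (square y)))))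

  exceptions⇒ω-𝔭⁻<π : ∀ {y n} → y ∈ exceptions → y * y < n → n ≤ suc y * suc y → ω (𝔭⁻ n) < π y
  exceptions⇒ω-𝔭⁻<π (here refl)                 = HasMissingPrime⇒ω-𝔭⁻<π missing-19
  exceptions⇒ω-𝔭⁻<π (there (here refl))         = HasMissingPrime⇒ω-𝔭⁻<π missing-109
  exceptions⇒ω-𝔭⁻<π (there (there (here refl))) = HasMissingPrime⇒ω-𝔭⁻<π missing-113

  ^ω-𝔭⁻≼ : ∀ {y n} → y * y < n → n ≤ suc y * suc y → suc y ^ ω (𝔭⁻ n) ≼ y * 125
  ^ω-𝔭⁻≼ {y} {n} y²<n n≤ with proj₂ (bounded y)
  ... | regular Y^π≼           = ≼-mono (^-monoʳ-≤ (suc y) (ω-𝔭⁻≤π n≤)) ≤-refl Y^π≼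
  ... | exceptional y∈ Y^predπ≼ = ≼-mono (^-monoʳ-≤ (suc y) (pred-mono-≤ (exceptions⇒ω-𝔭⁻<π y∈ y²<n n≤))) ≤-refl Y^predπ≼

  n^ω-𝔭⁻≼ : ∀ {y n} → y * y < n → n ≤ suc y * suc y → n ^ ω (𝔭⁻ n) ≼ y * 250
  n^ω-𝔭⁻≼ {y} {n} y²<n n≤ = ≼-mono
    (≤-trans (^-monoˡ-≤ (ω (𝔭⁻ n)) n≤) (≤-reflexive (^-distribʳ-* (suc y) (suc y) (ω (𝔭⁻ n)))))
    (≤-reflexive (sym (*-distribˡ-+ y 125 125)))
    (≼-* (^ω-𝔭⁻≼ y²<n n≤) (^ω-𝔭⁻≼ y²<n n≤))

open PrimeCounting

module Exponential where

  import Data.Integer as ℤ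
  import Data.Integer.Properties as ℤ
  open import Data.Nat as ℕ using (ℕ; zero; suc)
  import Data.Nat.Properties as ℕ
  open import Data.Rational
  open import Data.Rational.Properties
  open import Data.Rational.Solver using (module +-*-Solver)
  import Data.Rational.Unnormalised as ℚᵘ
  import Data.Rational.Unnormalised.Properties as ℚᵘ
  open +-*-Solver

  -- Natural numbers as rationals

  ι : ℕ → ℚᵘ.ℚᵘ
  ι m = ℚᵘ.mkℚᵘ (ℤ.+ m) 0

  ℕ→ℚ-via-ℚᵘ : ∀ m → toℚᵘ (ℕ→ℚ m) ℚᵘ.≃ ι m
  ℕ→ℚ-via-ℚᵘ m = toℚᵘ-fromℚᵘ (ι m)

  ℕ→ℚ-+ : ∀ m n → ℕ→ℚ (m ℕ.+ n) ≡ ℕ→ℚ m + ℕ→ℚ n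
  ℕ→ℚ-+ m n = toℚᵘ-injective (ℚᵘ.≃-trans (ℕ→ℚ-via-ℚᵘ (m ℕ.+ n)) (ℚᵘ.≃-trans (ℚᵘ.*≡* eq)
    (ℚᵘ.≃-sym (ℚᵘ.≃-trans (toℚᵘ-homo-+ (ℕ→ℚ m) (ℕ→ℚ n)) (ℚᵘ.+-cong (ℕ→ℚ-via-ℚᵘ m) (ℕ→ℚ-via-ℚᵘ n))))))
    where
    eq : ℤ.+ (m ℕ.+ n) ℤ.* ℤ.+ 1 ≡ (ℤ.+ m ℤ.* ℤ.+ 1 ℤ.+ ℤ.+ n ℤ.* ℤ.+ 1) ℤ.* ℤ.+ 1
    eq = cong (ℤ._* ℤ.+ 1) (sym (cong₂ ℤ._+_ (ℤ.*-identityʳ (ℤ.+ m)) (ℤ.*-identityʳ (ℤ.+ n))))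

  ℕ→ℚ-* : ∀ m n → ℕ→ℚ (m ℕ.* n) ≡ ℕ→ℚ m * ℕ→ℚ n
  ℕ→ℚ-* m n = toℚᵘ-injective (ℚᵘ.≃-trans (ℕ→ℚ-via-ℚᵘ (m ℕ.* n)) (ℚᵘ.≃-trans (ℚᵘ.*≡* (cong (ℤ._* ℤ.+ 1) (ℤ.pos-* m n)))
    (ℚᵘ.≃-sym (ℚᵘ.≃-trans (toℚᵘ-homo-* (ℕ→ℚ m) (ℕ→ℚ n)) (ℚᵘ.*-cong (ℕ→ℚ-via-ℚᵘ m) (ℕ→ℚ-via-ℚᵘ n))))))

  ℕ→ℚ-mono-≤ : ∀ {m n} → m ℕ.≤ n → ℕ→ℚ m ≤ ℕ→ℚ n
  ℕ→ℚ-mono-≤ {m} {n} m≤n = toℚᵘ-cancel-≤ (ℚᵘ.≤-respˡ-≃ (ℚᵘ.≃-sym (ℕ→ℚ-via-ℚᵘ m)) (ℚᵘ.≤-respʳ-≃ (ℚᵘ.≃-sym (ℕ→ℚ-via-ℚᵘ n))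
    (ℚᵘ.*≤* (ℤ.*-monoʳ-≤-nonNeg (ℤ.+ 1) (ℤ.+≤+ m≤n)))))

  ℕ→ℚ-mono-< : ∀ {m n} → m ℕ.< n → ℕ→ℚ m < ℕ→ℚ n
  ℕ→ℚ-mono-< {m} {n} m<n = toℚᵘ-cancel-< (ℚᵘ.<-respˡ-≃ (ℚᵘ.≃-sym (ℕ→ℚ-via-ℚᵘ m)) (ℚᵘ.<-respʳ-≃ (ℚᵘ.≃-sym (ℕ→ℚ-via-ℚᵘ n))
    (ℚᵘ.*<* (ℤ.*-monoʳ-<-pos (ℤ.+ 1) (ℤ.+<+ m<n)))))

  ℕ→ℚ-suc : ∀ n → ℕ→ℚ (suc n) ≡ 1ℚ + ℕ→ℚ n
  ℕ→ℚ-suc n = ℕ→ℚ-+ 1 n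

  ℕ→ℚ-inverse : ∀ j → ℕ→ℚ (suc j) * (ℤ.+ 1 / suc j) ≡ 1ℚ
  ℕ→ℚ-inverse j = toℚᵘ-injective (ℚᵘ.≃-trans (toℚᵘ-homo-* (ℕ→ℚ (suc j)) (ℤ.+ 1 / suc j))
    (ℚᵘ.≃-trans (ℚᵘ.*-cong (ℕ→ℚ-via-ℚᵘ (suc j)) (toℚᵘ-fromℚᵘ (ℚᵘ.mkℚᵘ (ℤ.+ 1) j))) (ℚᵘ.*≡* eq)))
    where
    eq : ℤ.+ suc j ℤ.* ℤ.+ 1 ℤ.* ℤ.+ 1 ≡ ℤ.+ 1 ℤ.* ℤ.+ suc (j ℕ.+ 0)
    eq = trans (trans (ℤ.*-identityʳ _) (ℤ.*-identityʳ _)) (trans (cong (ℤ.+_ ∘ suc) (sym (ℕ.+-identityʳ j))) (sym (ℤ.*-identityˡ _)))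

  -- Formal power series and the addition law of exp

  partialSum : (ℕ → ℚ) → ℕ → ℚ
  partialSum f zero    = f 0
  partialSum f (suc K) = f 0 + partialSum (f ∘ suc) K

  cauchy : (ℕ → ℚ) → (ℕ → ℚ) → ℕ → ℚ
  cauchy f g zero    = f 0 * g 0
  cauchy f g (suc k) = f 0 * g (suc k) + cauchy (f ∘ suc) g k

  derivative : (ℕ → ℚ) → ℕ → ℚ
  derivative f k = ℕ→ℚ (suc k) * f (suc k)

  cauchy-congˡ : ∀ {f f′} g k → (∀ i → f i ≡ f′ i) → cauchy f g k ≡ cauchy f′ g k
  cauchy-congˡ g zero    f≡ = cong (_* g 0) (f≡ 0)
  cauchy-congˡ g (suc k) f≡ = cong₂ _+_ (cong (_* g (suc k)) (f≡ 0)) (cauchy-congˡ g k (f≡ ∘ suc))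

  cauchy-congʳ : ∀ f {g g′} k → (∀ i → g i ≡ g′ i) → cauchy f g k ≡ cauchy f g′ k
  cauchy-congʳ f zero    g≡ = cong (f 0 *_) (g≡ 0)
  cauchy-congʳ f (suc k) g≡ = cong₂ _+_ (cong (f 0 *_) (g≡ (suc k))) (cauchy-congʳ (f ∘ suc) k g≡)

  cauchy-+ˡ : ∀ f f′ g k → cauchy (λ i → f i + f′ i) g k ≡ cauchy f g k + cauchy f′ g k
  cauchy-+ˡ f f′ g zero    = *-distribʳ-+ (g 0) (f 0) (f′ 0)
  cauchy-+ˡ f f′ g (suc k) = trans (cong (((f 0 + f′ 0) * g (suc k)) +_) (cauchy-+ˡ (f ∘ suc) (f′ ∘ suc) g k))
    (solve 5 (λ a b c d e → (a :+ b) :* c :+ (d :+ e) := (a :* c :+ d) :+ (b :* c :+ e)) refl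
      (f 0) (f′ 0) (g (suc k)) (cauchy (f ∘ suc) g k) (cauchy (f′ ∘ suc) g k))

  cauchy-*ˡ : ∀ c f g k → cauchy (λ i → c * f i) g k ≡ c * cauchy f g k
  cauchy-*ˡ c f g zero    = *-assoc c (f 0) (g 0)
  cauchy-*ˡ c f g (suc k) = trans (cong ((c * f 0 * g (suc k)) +_) (cauchy-*ˡ c (f ∘ suc) g k))
    (solve 4 (λ c a b d → c :* a :* b :+ c :* d := c :* (a :* b :+ d)) refl c (f 0) (g (suc k)) (cauchy (f ∘ suc) g k))

  cauchy-*ʳ : ∀ c f g k → cauchy f (λ i → c * g i) k ≡ c * cauchy f g k
  cauchy-*ʳ c f g zero    = solve 3 (λ a b c → a :* (c :* b) := c :* (a :* b)) refl (f 0) (g 0) c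
  cauchy-*ʳ c f g (suc k) = trans (cong ((f 0 * (c * g (suc k))) +_) (cauchy-*ʳ c (f ∘ suc) g k))
    (solve 4 (λ c a b d → a :* (c :* b) :+ c :* d := c :* (a :* b :+ d)) refl c (f 0) (g (suc k)) (cauchy (f ∘ suc) g k))

  -- Write f = f 0 + x F with the shifted series F, whose contribution to the derivative is F + x
  -- F'. The summand F is the 1 split off from the factor k + 2, and the rest is the rule for F.
  leibniz : ∀ f g k → derivative (cauchy f g) k ≡ cauchy (derivative f) g k + cauchy f (derivative g) k
  leibniz f g zero =
    solve 4 (λ a b c d → con 1ℚ :* (a :* d :+ b :* c) := con 1ℚ :* b :* c :+ a :* (con 1ℚ :* d)) refl (f 0) (f 1) (g 0) (g 1)
  leibniz f g (suc k) = begin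
    ℕ→ℚ (suc (suc k)) * (f 0 * g (suc (suc k)) + (f 1 * g (suc k) + cauchy f″ g k))
      ≡⟨ cong (_* (f 0 * g (suc (suc k)) + (f 1 * g (suc k) + cauchy f″ g k))) (ℕ→ℚ-suc (suc k)) ⟩
    (1ℚ + n) * (f 0 * g (suc (suc k)) + (f 1 * g (suc k) + cauchy f″ g k))
      ≡⟨ solve 6 (λ n a b c d e → (con 1ℚ :+ n) :* (a :* b :+ (c :* d :+ e)) := n :* (c :* d :+ e) :+ (con 1ℚ :* c :* d :+ e :+ a :* ((con 1ℚ :+ n) :* b))) refl
          n (f 0) (g (suc (suc k))) (f 1) (g (suc k)) (cauchy f″ g k) ⟩
    derivative (cauchy f′ g) k + (1ℚ * f 1 * g (suc k) + cauchy f″ g k + f 0 * ((1ℚ + n) * g (suc (suc k))))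
      ≡⟨ cong₂ (λ u v → u + (1ℚ * f 1 * g (suc k) + cauchy f″ g k + f 0 * (v * g (suc (suc k))))) (leibniz f′ g k) (sym (ℕ→ℚ-suc (suc k))) ⟩
    cauchy (derivative f′) g k + cauchy f′ (derivative g) k + (1ℚ * f 1 * g (suc k) + cauchy f″ g k + f 0 * derivative g (suc k))
      ≡⟨ solve 5 (λ a b c d e → a :+ b :+ (c :+ d :+ e) := c :+ (a :+ d) :+ (e :+ b)) refl
          (cauchy (derivative f′) g k) (cauchy f′ (derivative g) k) (1ℚ * f 1 * g (suc k)) (cauchy f″ g k) (f 0 * derivative g (suc k)) ⟩
    derivative f 0 * g (suc k) + (cauchy (derivative f′) g k + cauchy f″ g k) + (f 0 * derivative g (suc k) + cauchy f′ (derivative g) k)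
      ≡⟨ cong (λ u → derivative f 0 * g (suc k) + u + (f 0 * derivative g (suc k) + cauchy f′ (derivative g) k))
          (trans (sym (cauchy-+ˡ (derivative f′) f″ g k)) (cauchy-congˡ g k shifted)) ⟩
    cauchy (derivative f) g (suc k) + cauchy f (derivative g) (suc k)  ∎
    where
    open ≡-Reasoning
    f′ = f ∘ suc
    f″ = f ∘ suc ∘ suc
    n  = ℕ→ℚ (suc k)
    shifted : ∀ i → derivative f′ i + f″ i ≡ derivative f (suc i)
    shifted i = sym (trans (cong (_* f″ i) (ℕ→ℚ-suc (suc i)))
      (solve 2 (λ n a → (con 1ℚ :+ n) :* a := n :* a :+ a) refl (ℕ→ℚ (suc i)) (f″ i)))

  derivative-expTerm : ∀ q k → derivative (expTerm q) k ≡ q * expTerm q k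
  derivative-expTerm q k = begin
    ℕ→ℚ (suc k) * (expTerm q k * q * (ℤ.+ 1 / suc k))
      ≡⟨ solve 4 (λ n t q i → n :* (t :* q :* i) := n :* i :* (q :* t)) refl (ℕ→ℚ (suc k)) (expTerm q k) q (ℤ.+ 1 / suc k) ⟩
    ℕ→ℚ (suc k) * (ℤ.+ 1 / suc k) * (q * expTerm q k)    ≡⟨ cong (_* (q * expTerm q k)) (ℕ→ℚ-inverse k) ⟩
    1ℚ * (q * expTerm q k)                             ≡⟨ *-identityˡ (q * expTerm q k) ⟩
    q * expTerm q k                                    ∎
    where open ≡-Reasoning

  derivative⇒next : ∀ f k → f (suc k) ≡ derivative f k * (ℤ.+ 1 / suc k)
  derivative⇒next f k = sym (begin
    ℕ→ℚ (suc k) * f (suc k) * (ℤ.+ 1 / suc k)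
      ≡⟨ solve 3 (λ n t i → n :* t :* i := n :* i :* t) refl (ℕ→ℚ (suc k)) (f (suc k)) (ℤ.+ 1 / suc k) ⟩
    ℕ→ℚ (suc k) * (ℤ.+ 1 / suc k) * f (suc k)            ≡⟨ cong (_* f (suc k)) (ℕ→ℚ-inverse k) ⟩
    1ℚ * f (suc k)                                     ≡⟨ *-identityˡ (f (suc k)) ⟩
    f (suc k)                                          ∎)
    where open ≡-Reasoning

  -- Both series solve E' = (a + b) E with constant term 1, and this determines the coefficients one
  -- after the other. No binomial coefficients enter.
  cauchy-expTerm : ∀ a b k → cauchy (expTerm a) (expTerm b) k ≡ expTerm (a + b) k
  cauchy-expTerm a b zero    = *-identityˡ 1ℚ
  cauchy-expTerm a b (suc k) = begin
    E (suc k)                                          ≡⟨ derivative⇒next E k ⟩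
    derivative E k * (ℤ.+ 1 / suc k)                     ≡⟨ cong (_* (ℤ.+ 1 / suc k)) E′ ⟩
    expTerm (a + b) k * (a + b) * (ℤ.+ 1 / suc k)        ∎
    where
    open ≡-Reasoning
    E = cauchy (expTerm a) (expTerm b)
    E′ : derivative E k ≡ expTerm (a + b) k * (a + b)
    E′ = begin
      derivative E k
        ≡⟨ leibniz (expTerm a) (expTerm b) k ⟩
      cauchy (derivative (expTerm a)) (expTerm b) k + cauchy (expTerm a) (derivative (expTerm b)) k
        ≡⟨ cong₂ _+_ (trans (cauchy-congˡ (expTerm b) k (derivative-expTerm a)) (cauchy-*ˡ a (expTerm a) (expTerm b) k))
                     (trans (cauchy-congʳ (expTerm a) k (derivative-expTerm b)) (cauchy-*ʳ b (expTerm a) (expTerm b) k)) ⟩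
      a * E k + b * E k
        ≡⟨ solve 3 (λ a b e → a :* e :+ b :* e := e :* (a :+ b)) refl a b (E k) ⟩
      E k * (a + b)
        ≡⟨ cong (_* (a + b)) (cauchy-expTerm a b k) ⟩
      expTerm (a + b) k * (a + b)  ∎

  -- Products of partial sums

  0≤* : ∀ {p q} → 0ℚ ≤ p → 0ℚ ≤ q → 0ℚ ≤ p * q
  0≤* {p} {q} 0≤p 0≤q = nonNegative⁻¹ (p * q) {{nonNeg*nonNeg⇒nonNeg p {{nonNegative 0≤p}} q {{nonNegative 0≤q}}}}

  ≤+ : ∀ p {q} → 0ℚ ≤ q → p ≤ p + q
  ≤+ p 0≤q = ≤-trans (≤-reflexive (sym (+-identityʳ p))) (+-monoʳ-≤ p 0≤q)

  partialSum-mono : ∀ {f g} K → (∀ i → f i ≤ g i) → partialSum f K ≤ partialSum g K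
  partialSum-mono zero    f≤g = f≤g 0
  partialSum-mono (suc K) f≤g = +-mono-≤ (f≤g 0) (partialSum-mono K (f≤g ∘ suc))

  partialSum-cong : ∀ {f g} K → (∀ i → f i ≡ g i) → partialSum f K ≡ partialSum g K
  partialSum-cong zero    f≡g = f≡g 0
  partialSum-cong (suc K) f≡g = cong₂ _+_ (f≡g 0) (partialSum-cong K (f≡g ∘ suc))

  partialSum-+ : ∀ f g K → partialSum (λ i → f i + g i) K ≡ partialSum f K + partialSum g K
  partialSum-+ f g zero    = refl
  partialSum-+ f g (suc K) = trans (cong ((f 0 + g 0) +_) (partialSum-+ (f ∘ suc) (g ∘ suc) K))
    (solve 4 (λ a b c d → a :+ b :+ (c :+ d) := a :+ c :+ (b :+ d)) refl (f 0) (g 0) (partialSum (f ∘ suc) K) (partialSum (g ∘ suc) K))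

  partialSum-* : ∀ c f K → partialSum (λ i → c * f i) K ≡ c * partialSum f K
  partialSum-* c f zero    = refl
  partialSum-* c f (suc K) = trans (cong ((c * f 0) +_) (partialSum-* c (f ∘ suc) K)) (sym (*-distribˡ-+ c (f 0) (partialSum (f ∘ suc) K)))

  partialSum-suc : ∀ f K → partialSum f (suc K) ≡ partialSum f K + f (suc K)
  partialSum-suc f zero    = refl
  partialSum-suc f (suc K) = trans (cong (f 0 +_) (partialSum-suc (f ∘ suc) K)) (sym (+-assoc (f 0) (partialSum (f ∘ suc) K) (f (suc (suc K)))))

  0≤partialSum : ∀ {f} K → (∀ i → 0ℚ ≤ f i) → 0ℚ ≤ partialSum f K
  0≤partialSum zero    0≤f = 0≤f 0
  0≤partialSum (suc K) 0≤f = ≤-trans (0≤f 0) (≤+ _ (0≤partialSum K (0≤f ∘ suc)))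

  partialSum-≤ : ∀ {f} K M → (∀ i → 0ℚ ≤ f i) → partialSum f M ≤ partialSum f (K ℕ.+ M)
  partialSum-≤         zero    M 0≤f = ≤-refl
  partialSum-≤ {f} (suc K) M 0≤f = ≤-trans (partialSum-≤ K M 0≤f)
    (≤-trans (≤+ _ (0≤f (suc (K ℕ.+ M)))) (≤-reflexive (sym (partialSum-suc f (K ℕ.+ M)))))

  0≤cauchy : ∀ {f g} k → (∀ i → 0ℚ ≤ f i) → (∀ i → 0ℚ ≤ g i) → 0ℚ ≤ cauchy f g k
  0≤cauchy zero    0≤f 0≤g = 0≤* (0≤f 0) (0≤g 0)
  0≤cauchy (suc k) 0≤f 0≤g = ≤-trans (0≤* (0≤f 0) (0≤g (suc k))) (≤+ _ (0≤cauchy k (0≤f ∘ suc) 0≤g))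

  f0*g≤cauchy : ∀ {f g} k → (∀ i → 0ℚ ≤ f i) → (∀ i → 0ℚ ≤ g i) → f 0 * g k ≤ cauchy f g k
  f0*g≤cauchy zero    0≤f 0≤g = ≤-refl
  f0*g≤cauchy (suc k) 0≤f 0≤g = ≤+ _ (0≤cauchy k (0≤f ∘ suc) 0≤g)

  -- The products of f i and g j over the rectangle i ≤ K, j ≤ M are among those over the triangle i
  -- + j ≤ K + M, and no product is negative.
  partialSum-*-≤ : ∀ {f g} K M → (∀ i → 0ℚ ≤ f i) → (∀ i → 0ℚ ≤ g i) →
    partialSum f K * partialSum g M ≤ partialSum (cauchy f g) (K ℕ.+ M)
  partialSum-*-≤ {f} {g} zero    M 0≤f 0≤g =
    ≤-trans (≤-reflexive (sym (partialSum-* (f 0) g M))) (partialSum-mono M (λ k → f0*g≤cauchy {f} {g} k 0≤f 0≤g))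
  partialSum-*-≤ {f} {g} (suc K) M 0≤f 0≤g = begin
    (f 0 + partialSum f′ K) * partialSum g M
      ≡⟨ *-distribʳ-+ (partialSum g M) (f 0) (partialSum f′ K) ⟩
    f 0 * partialSum g M + partialSum f′ K * partialSum g M
      ≤⟨ +-mono-≤ (*-monoˡ-≤-nonNeg (f 0) {{nonNegative (0≤f 0)}} (partialSum-≤ (suc K) M 0≤g)) (partialSum-*-≤ K M (0≤f ∘ suc) 0≤g) ⟩
    f 0 * (g 0 + partialSum (g ∘ suc) (K ℕ.+ M)) + partialSum (cauchy f′ g) (K ℕ.+ M)
      ≡⟨ solve 4 (λ a b c d → a :* (b :+ c) :+ d := a :* b :+ (a :* c :+ d)) refl (f 0) (g 0) (partialSum (g ∘ suc) (K ℕ.+ M)) (partialSum (cauchy f′ g) (K ℕ.+ M)) ⟩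
    f 0 * g 0 + (f 0 * partialSum (g ∘ suc) (K ℕ.+ M) + partialSum (cauchy f′ g) (K ℕ.+ M))
      ≡⟨ cong (λ u → f 0 * g 0 + (u + partialSum (cauchy f′ g) (K ℕ.+ M))) (sym (partialSum-* (f 0) (g ∘ suc) (K ℕ.+ M))) ⟩
    f 0 * g 0 + (partialSum (λ i → f 0 * g (suc i)) (K ℕ.+ M) + partialSum (cauchy f′ g) (K ℕ.+ M))
      ≡⟨ cong (f 0 * g 0 +_) (sym (partialSum-+ (λ i → f 0 * g (suc i)) (cauchy f′ g) (K ℕ.+ M))) ⟩
    partialSum (cauchy f g) (suc K ℕ.+ M)  ∎
    where
    open ≤-Reasoning
    f′ = f ∘ suc

  partialSum-expTerm : ∀ q K → partialSum (expTerm q) K ≡ expSum q K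
  partialSum-expTerm q zero    = refl
  partialSum-expTerm q (suc K) = trans (partialSum-suc (expTerm q) K) (cong (_+ expTerm q (suc K)) (partialSum-expTerm q K))

  0<1/suc : ∀ j → Positive (ℤ.+ 1 / suc j)
  0<1/suc j = normalize-pos 1 (suc j)

  0≤expTerm : ∀ {q} → 0ℚ ≤ q → ∀ j → 0ℚ ≤ expTerm q j
  0≤expTerm 0≤q zero    = nonNegative⁻¹ 1ℚ
  0≤expTerm 0≤q (suc j) = 0≤* (0≤* (0≤expTerm 0≤q j) 0≤q) (<⇒≤ (positive⁻¹ _ {{0<1/suc j}}))

  expTerm-positive : ∀ q .{{_ : Positive q}} j → Positive (expTerm q j)
  expTerm-positive q zero    = _
  expTerm-positive q (suc j) = pos*pos⇒pos (expTerm q j * q) {{pos*pos⇒pos (expTerm q j) {{expTerm-positive q j}} q}} (ℤ.+ 1 / suc j) {{0<1/suc j}}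

  expSum-*-≤ : ∀ {a b} K M → 0ℚ ≤ a → 0ℚ ≤ b → expSum a K * expSum b M ≤ expSum (a + b) (K ℕ.+ M)
  expSum-*-≤ {a} {b} K M 0≤a 0≤b = begin
    expSum a K * expSum b M                                   ≡⟨ cong₂ _*_ (partialSum-expTerm a K) (partialSum-expTerm b M) ⟨
    partialSum (expTerm a) K * partialSum (expTerm b) M       ≤⟨ partialSum-*-≤ K M (0≤expTerm 0≤a) (0≤expTerm 0≤b) ⟩
    partialSum (cauchy (expTerm a) (expTerm b)) (K ℕ.+ M)     ≡⟨ partialSum-cong (K ℕ.+ M) (cauchy-expTerm a b) ⟩
    partialSum (expTerm (a + b)) (K ℕ.+ M)                    ≡⟨ partialSum-expTerm (a + b) (K ℕ.+ M) ⟩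
    expSum (a + b) (K ℕ.+ M)                                  ∎
    where open ≤-Reasoning

  -- From powers of 20201/20000 to `LogBound`

  h : ℚ
  h = ℤ.+ 1 / 100

  _^ℚ_ : ℚ → ℕ → ℚ
  p ^ℚ zero  = 1ℚ
  p ^ℚ suc N = p * (p ^ℚ N)

  0≤ℕ→ℚ : ∀ n → 0ℚ ≤ ℕ→ℚ n
  0≤ℕ→ℚ n = ℕ→ℚ-mono-≤ {0} {n} ℕ.z≤n

  0≤h : 0ℚ ≤ h
  0≤h = nonNegative⁻¹ h

  0≤^ℚ : ∀ {p} → 0ℚ ≤ p → ∀ N → 0ℚ ≤ p ^ℚ N
  0≤^ℚ 0≤p zero    = nonNegative⁻¹ 1ℚ
  0≤^ℚ 0≤p (suc N) = 0≤* 0≤p (0≤^ℚ 0≤p N)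

  expSum-^-≤ : ∀ {a K} → 0ℚ ≤ a → ∀ N → expSum a K ^ℚ N ≤ expSum (ℕ→ℚ N * a) (N ℕ.* K)
  expSum-^-≤ {a} {K} 0≤a zero    = ≤-refl
  expSum-^-≤ {a} {K} 0≤a (suc N) = begin
    expSum a K * (expSum a K ^ℚ N)                     ≤⟨ *-monoˡ-≤-nonNeg (expSum a K) {{nonNegative 0≤E}} (expSum-^-≤ {a} {K} 0≤a N) ⟩
    expSum a K * expSum (ℕ→ℚ N * a) (N ℕ.* K)          ≤⟨ expSum-*-≤ K (N ℕ.* K) 0≤a (0≤* (0≤ℕ→ℚ N) 0≤a) ⟩
    expSum (a + ℕ→ℚ N * a) (K ℕ.+ N ℕ.* K)             ≡⟨ cong (λ q → expSum q (K ℕ.+ N ℕ.* K)) a+Na ⟩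
    expSum (ℕ→ℚ (suc N) * a) (suc N ℕ.* K)             ∎
    where
    open ≤-Reasoning
    0≤E : 0ℚ ≤ expSum a K
    0≤E = ≤-trans (0≤partialSum K (0≤expTerm 0≤a)) (≤-reflexive (partialSum-expTerm a K))
    a+Na : a + ℕ→ℚ N * a ≡ ℕ→ℚ (suc N) * a
    a+Na = trans (solve 2 (λ a n → a :+ n :* a := (con 1ℚ :+ n) :* a) refl a (ℕ→ℚ N)) (cong (_* a) (sym (ℕ→ℚ-suc N)))

  expSum-h-^ : ∀ N → (expSum h 2 ^ℚ N) * ℕ→ℚ (20000 ℕ.^ N) ≡ ℕ→ℚ (20201 ℕ.^ N)
  expSum-h-^ zero    = refl
  expSum-h-^ (suc N) = begin
    expSum h 2 * (expSum h 2 ^ℚ N) * ℕ→ℚ (20000 ℕ.* 20000 ℕ.^ N)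
      ≡⟨ cong (expSum h 2 * (expSum h 2 ^ℚ N) *_) (ℕ→ℚ-* 20000 (20000 ℕ.^ N)) ⟩
    expSum h 2 * (expSum h 2 ^ℚ N) * (ℕ→ℚ 20000 * ℕ→ℚ (20000 ℕ.^ N))
      ≡⟨ solve 4 (λ a b c d → a :* b :* (c :* d) := a :* c :* (b :* d)) refl (expSum h 2) (expSum h 2 ^ℚ N) (ℕ→ℚ 20000) (ℕ→ℚ (20000 ℕ.^ N)) ⟩
    -- `expSum h 2` evaluates to 1 + 1/100 + 1/20000 = 20201/20000, the base g of `_≼_`.
    expSum h 2 * ℕ→ℚ 20000 * ((expSum h 2 ^ℚ N) * ℕ→ℚ (20000 ℕ.^ N))          ≡⟨ cong (ℕ→ℚ 20201 *_) (expSum-h-^ N) ⟩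
    ℕ→ℚ 20201 * ℕ→ℚ (20201 ℕ.^ N)                                             ≡⟨ ℕ→ℚ-* 20201 (20201 ℕ.^ N) ⟨
    ℕ→ℚ (20201 ℕ.* 20201 ℕ.^ N)                                               ∎
    where open ≡-Reasoning

  ≼⇒≤expSum : ∀ {a N} → a ≼ N → ℕ→ℚ a ≤ expSum (ℕ→ℚ N * h) (N ℕ.* 2)
  ≼⇒≤expSum {a} {N} (mk≼ a≼N) = ≤-trans (*-cancelʳ-≤-pos D {{positive 0<D}} (begin
    ℕ→ℚ a * D                       ≡⟨ ℕ→ℚ-* a (20000 ℕ.^ N) ⟨
    ℕ→ℚ (a ℕ.* 20000 ℕ.^ N)         ≤⟨ ℕ→ℚ-mono-≤ a≼N ⟩
    ℕ→ℚ (20201 ℕ.^ N)               ≡⟨ expSum-h-^ N ⟨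
    (expSum h 2 ^ℚ N) * D           ∎)) (expSum-^-≤ {h} {2} 0≤h N)
    where
    open ≤-Reasoning
    D = ℕ→ℚ (20000 ℕ.^ N)
    0<D : 0ℚ < D
    0<D = ℕ→ℚ-mono-< (ℕ.m^n>0 20000 N)

  logBound : ∀ {w n} y → 0 ℕ.< y → y ℕ.* y ℕ.< n → n ℕ.^ w ≼ y ℕ.* 250 → LogBound w n
  -- q is 250 y / 100 = (5/2) y, hence 4 q² = 25 y² < 25 n. The sum is taken one term further than
  -- `≼⇒≤expSum` provides, and this positive term makes the inequality strict.
  logBound {w} {n} y 0<y y²<n n^w≼ = q , <⇒≤ 0<q , 4q²<25n , suc (N ℕ.* 2) , n^w<
    where
    open ≤-Reasoning
    N = y ℕ.* 250
    q = ℕ→ℚ N * h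
    0<q : 0ℚ < q
    0<q = positive⁻¹ q {{pos*pos⇒pos (ℕ→ℚ N) {{positive (ℕ→ℚ-mono-< {0} {N} (ℕ.*-mono-≤ 0<y (ℕ.s≤s {0} {249} ℕ.z≤n)))}} h}}
    4q²<25n : ℕ→ℚ 4 * q * q < ℕ→ℚ (25 ℕ.* n)
    4q²<25n = begin-strict
      ℕ→ℚ 4 * q * q                                                   ≡⟨ cong (λ r → ℕ→ℚ 4 * (r * h) * (r * h)) (ℕ→ℚ-* y 250) ⟩
      ℕ→ℚ 4 * (ℕ→ℚ y * ℕ→ℚ 250 * h) * (ℕ→ℚ y * ℕ→ℚ 250 * h)
        ≡⟨ solve 4 (λ a b c d → a :* (b :* c :* d) :* (b :* c :* d) := a :* (c :* d) :* (c :* d) :* (b :* b)) refl (ℕ→ℚ 4) (ℕ→ℚ y) (ℕ→ℚ 250) h ⟩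
      ℕ→ℚ 25 * (ℕ→ℚ y * ℕ→ℚ y)                                        ≡⟨ cong (ℕ→ℚ 25 *_) (ℕ→ℚ-* y y) ⟨
      ℕ→ℚ 25 * ℕ→ℚ (y ℕ.* y)                                          ≡⟨ ℕ→ℚ-* 25 (y ℕ.* y) ⟨
      ℕ→ℚ (25 ℕ.* (y ℕ.* y))                                          <⟨ ℕ→ℚ-mono-< (ℕ.*-monoʳ-< 25 y²<n) ⟩
      ℕ→ℚ (25 ℕ.* n)                                                  ∎
    n^w< : ℕ→ℚ (n ℕ.^ w) < expSum q (suc (N ℕ.* 2))
    n^w< = begin-strict
      ℕ→ℚ (n ℕ.^ w)                                                   ≤⟨ ≼⇒≤expSum n^w≼ ⟩
      expSum q (N ℕ.* 2)                                              ≡⟨ +-identityʳ _ ⟨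
      expSum q (N ℕ.* 2) + 0ℚ
        <⟨ +-monoʳ-< (expSum q (N ℕ.* 2)) (positive⁻¹ _ {{expTerm-positive q {{positive 0<q}} (suc (N ℕ.* 2))}}) ⟩
      expSum q (suc (N ℕ.* 2))                                        ∎

open Exponential using (logBound)

open import Data.Nat using (ℕ; suc; _*_; _∸_; _≤_; _<_)

theorem4 : ∀ (n : ℕ) → 2 ≤ n →
    (∃[ L ] (Unique L
    × (∀ (p : ℕ) → (p ∈ L) ⇔ (Prime p × n < p * p × (n div p) < ((n ∸ 1) div (p ∸ 1))))
    × ω (𝔭⁺ n) ≡ length L))
    × LogBound (ω (𝔭⁻ n)) n
    × ω (𝔭⁺ n) * ω (𝔭⁺ n) < n
theorem4 n@(suc k) 1<n =
  (largePrimes n , largePrimes-unique n , ∈-largePrimes k , ω-𝔭⁺ n) ,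
  (let y , 0<y , y²<n , n≤ = root n 1<n
   in logBound {ω (𝔭⁻ n)} {n} y 0<y y²<n (n^ω-𝔭⁻≼ {y} {n} y²<n n≤)) ,
  ω-𝔭⁺-<√ n 1<n
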